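{- For each of the calculi $\mathcal{E}$, $\mathcal{E}^{r}$, $\mathcal{F}_{2015}$, $\mathcal{M}'_{2015}$ and $\mathcal{M}_{2015}$, the derivability problem restricted to its one-division fragment is algorithmically undecidable; here the one-division fragment consists of the sequents all of whose formulae are built from variables using only $/$, $!$ and (for the bracketed calculi) $\langle\rangle$ and $[]^{ -1}$, possibly with brackets in the antecedent.
   Context: Formulae are built from a countable set of variables and $\mathbf1$ by $\backslash,/,\cdot,\wedge,\vee$ and the unary $\langle\rangle$, $[]^{ -1}$, $!$. Bracket-free calculi: sequents $\Pi\to A$ with $\Pi$ a finite (possibly empty, $\Lambda$) sequence of formulae without bracket modalities. $\mathcal{E}$ has axioms $A\to A$, $\Lambda\to\mathbf1$ and rules: ($\backslash L$) from $\Pi\to A$ and $\Delta_1,B,\Delta_2\to C$ infer $\Delta_1,\Pi,A\backslash B,\Delta_2\to C$; ($\backslash R$) from $A,\Pi\to B$ infer $\Pi\to A\backslash B$; ($/L$) from $\Pi\to A$ and $\Delta_1,B,\Delta_2\to C$ infer $\Delta_1,B/A,\Pi,\Delta_2\to C$; ($/R$) from $\Pi,A\to B$ infer $\Pi\to B/A$; ($\cdot L$), ($\cdot R$), ($\mathbf1L$), ($\wedge L_i$), ($\wedge R$), ($\vee L$), ($\vee R_i$) as standard; ($!R$) from $!A_1,\dots,!A_n\to B$ infer $!A_1,\dots,!A_n\to!B$ ($n\ge0$); ($!L$) from $\Delta_1,A,\Delta_2\to C$ infer $\Delta_1,!A,\Delta_2\to C$; ($!P_1$) from $\Delta_1,!A,\Phi,\Delta_2\to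 C$ infer $\Delta_1,\Phi,!A,\Delta_2\to C$; ($!P_2$) the converse; ($!C$) from $\Delta_1,!A,!A,\Delta_2\to C$ infer $\Delta_1,!A,\Delta_2\to C$; ($!W$) from $\Delta_1,\Delta_2\to C$ infer $\Delta_1,!A,\Delta_2\to C$; (cut) from $\Pi\to A$ and $\Delta_1,A,\Delta_2\to C$ infer $\Delta_1,\Pi,\Delta_2\to C$. $\mathcal{E}^r$ is $\mathcal{E}$ without $!W$. Bracketed calculi with stoups: a stoup is a finite multiset of formulae ($\varnothing$ empty); a tree term is a formula or $[\Xi]$; a meta-formula is $\zeta;\Gamma$ ($\zeta$ a stoup, $\Gamma$ a finite sequence of tree terms, empty $\Lambda$), $\varnothing;\Gamma$ written $\Gamma$; comma is concatenation / multiset union; sequents $\Xi\to C$; $\Xi(\Theta)$ designates an occurrence of a meta-formula $\Theta$ which is $\Xi$ itself or the content of a bracket $[\Theta]$ at any depth. Common rules: axioms $A\to A$, $\Lambda\to\mathbf1$; ($/L$) from $\zeta_1;\Gamma\to B$ and $\Xi(\zeta_2;\Delta_1,C,\Delta_2)\to D$ infer $\Xi(\zeta_1,\zeta_2;\Delta_1,C/B,\Gamma,\Delta_2)\to D$; ($/R$) from $\zeta;\Gamma,B\to C$ infer $\zeta;\Gamma\to C/B$; ($\backslash L$) from $\zeta_1;\Gamma\to A$ and $\Xi(\zeta_2;\Delta_1,C,\Delta_2)\to D$ infer $\Xi(\zeta_1,\zeta_2;\Delta_1,\Gamma,A\backslash C,\Delta_2)\to D$; ($\backslash R$) from $\zeta;A,\Gamma\to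 C$ infer $\zeta;\Gamma\to A\backslash C$; ($\cdot L$) from $\Xi(\zeta;\Delta_1,A,B,\Delta_2)\to D$ infer $\Xi(\zeta;\Delta_1,A\cdot B,\Delta_2)\to D$; ($\cdot R$) from $\zeta_1;\Delta\to A$, $\zeta_2;\Gamma\to B$ infer $\zeta_1,\zeta_2;\Delta,\Gamma\to A\cdot B$; ($\mathbf1L$) from $\Xi(\zeta;\Delta_1,\Delta_2)\to A$ infer $\Xi(\zeta;\Delta_1,\mathbf1,\Delta_2)\to A$; additive rules with context $\Xi(\zeta;\Delta_1,\cdot,\Delta_2)$ on the left and arbitrary $\Xi$ on the right; ($[]^{ -1}L$) from $\Xi(\zeta;\Delta_1,A,\Delta_2)\to B$ infer $\Xi(\zeta;\Delta_1,[[]^{ -1}A],\Delta_2)\to B$; ($[]^{ -1}R$) from $[\Xi]\to A$ infer $\Xi\to[]^{ -1}A$; ($\langle\rangle L$) from $\Xi(\zeta;\Delta_1,[A],\Delta_2)\to B$ infer $\Xi(\zeta;\Delta_1,\langle\rangle A,\Delta_2)\to B$; ($\langle\rangle R$) from $\Xi\to A$ infer $[\Xi]\to\langle\rangle A$; ($!L$) from $\Xi(\zeta,A;\Gamma_1,\Gamma_2)\to B$ infer $\Xi(\zeta;\Gamma_1,!A,\Gamma_2)\to B$; ($!P$) from $\Xi(\zeta;\Gamma_1,A,\Gamma_2)\to B$ infer $\Xi(\zeta,A;\Gamma_1,\Gamma_2)\to B$. $\mathcal{M}_{2015}$ adds ($!R$) from $\zeta;\Lambda\to B$ infer $\zeta;\Lambda\to!B$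 and ($!C$) from $\Xi(\zeta_1,\zeta_2;\Gamma_1,[\zeta_2;\Gamma_2],\Gamma_3)\to B$ infer $\Xi(\zeta_1,\zeta_2;\Gamma_1,\Gamma_2,\Gamma_3)\to B$ if $\zeta_2\ne\varnothing$. $\mathcal{M}'_{2015}$ adds ($!R'$) as $!R$ but only if $\zeta\ne\varnothing$, and ($!C'$) from $\Xi(\zeta_1,\zeta_2;\Gamma_1,[\zeta',\zeta_2;\Gamma_2],\Gamma_3)\to C$ infer $\Xi(\zeta_1,\zeta_2,\zeta';\Gamma_1,\Gamma_2,\Gamma_3)\to C$ if $\zeta_2\neq\varnothing$. Cut is not a rule of these. Stoup-free $\mathcal{F}_{2015}$: meta-formulae are finite sequences of tree terms; rules are the stoup-free versions of the common rules (drop all stoups), except $!L$ is: from $\Xi(\Delta_1,A,\Delta_2)\to C$ infer $\Xi(\Delta_1,!A,\Delta_2)\to C$; plus ($!P_1$) from $\Xi(\Delta_1,!A,\Phi,\Delta_2)\to C$ infer $\Xi(\Delta_1,\Phi,!A,\Delta_2)\to C$, ($!P_2$) the converse, ($!R$) from $!A_1,\dots,!A_n\to B$ infer $!A_1,\dots,!A_n\to!B$ ($n\ge1$), ($!C$) from $\Xi(!A_1,\dots,!A_n,\Gamma_1,[!A_1,\dots,!A_n,\Gamma_2],\Gamma_3)\to C$ infer $\Xi(!A_1,\dots,!A_n,\Gamma_1,\Gamma_2,\Gamma_3)\to C$ ($n\ge1$), and (cut) from $\Pi\to A$ and $\Xi(\Gamma_1,A,\Gamma_2)\to C$ infer $\Xi(\Gamma_1,\Pi,\Gamma_2)\to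 C$. -}

module Defs where

open import Data.Bool using (Bool; true; false)
open import Data.Fin using (Fin)
open import Data.List using (List; []; _∷_; _++_; map; concatMap; replicate)
open import Data.List.Relation.Binary.Permutation.Propositional using (_↭_)
open import Data.List.Relation.Unary.All using (All)
open import Data.Nat using (ℕ)
open import Data.Product using (Σ; ∃; _×_; _,_; proj₁)
open import Data.Sum using (_⊎_; inj₁; inj₂)
open import Relation.Binary.Construct.Closure.ReflexiveTransitive using (Star)
open import Relation.Binary.PropositionalEquality using (_≢_)
open import Relation.Nullary using (¬_)

------------------------------------------------------------------------
-- Formulae

data Language : Set where
  bracketFree bracketed : Language

infixr 9 !_ ⟨⟩_ []⁻¹_
infix  8 _∖_ _/_
infixr 7 _·_
infixr 6 _∧_ _∨_

-- The bracket modalities exist only in the bracketed language, so that a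
-- calculus over Fm bracketFree cannot mention them even in a cut formula.
data Fm : Language → Set where
  var                 : ∀ {ℓ} → ℕ → Fm ℓ
  𝟏                   : ∀ {ℓ} → Fm ℓ
  _∖_ _/_ _·_ _∧_ _∨_ : ∀ {ℓ} → Fm ℓ → Fm ℓ → Fm ℓ
  !_                  : ∀ {ℓ} → Fm ℓ → Fm ℓ
  ⟨⟩_ []⁻¹_           : Fm bracketed → Fm bracketed

-- The formulae of the one-division fragment.
data OneDivision : ∀ {ℓ} → Fm ℓ → Set where
  var   : ∀ {ℓ} n → OneDivision {ℓ} (var n)
  _/_   : ∀ {ℓ} {B A : Fm ℓ} → OneDivision B → OneDivision A → OneDivision (B / A)
  !_    : ∀ {ℓ} {A : Fm ℓ} → OneDivision A → OneDivision (! A)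
  ⟨⟩_   : ∀ {A} → OneDivision A → OneDivision (⟨⟩ A)
  []⁻¹_ : ∀ {A} → OneDivision A → OneDivision ([]⁻¹ A)

------------------------------------------------------------------------
-- Sequents are written over the finite alphabet Token.

data Token : Set where
  tick x one under over times and or bang dia box : Token
  open[ close] semicolon arrow                    : Token

-- Polish notation, with the n-th variable written as n ticks followed by x.
-- No code of a formula is a proper prefix of another, so lists of formulae
-- need no separators.
codeFm : ∀ {ℓ} → Fm ℓ → List Token
codeFm (var n)  = replicate n tick ++ x ∷ []
codeFm 𝟏        = one ∷ []
codeFm (A ∖ B)  = under ∷ codeFm A ++ codeFm B
codeFm (B / A)  = over ∷ codeFm B ++ codeFm A
codeFm (A · B)  = times ∷ codeFm A ++ codeFm B
codeFm (A ∧ B)  = and ∷ codeFm A ++ codeFm B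
codeFm (A ∨ B)  = or ∷ codeFm A ++ codeFm B
codeFm (! A)    = bang ∷ codeFm A
codeFm (⟨⟩ A)   = dia ∷ codeFm A
codeFm ([]⁻¹ A) = box ∷ codeFm A

codeFms : ∀ {ℓ} → List (Fm ℓ) → List Token
codeFms = concatMap codeFm

------------------------------------------------------------------------
-- Deterministic Turing machines with one two-way infinite tape

module Turing (Input : Set) where

  data Symbol (k : ℕ) : Set where
    blank : Symbol k
    input : Input → Symbol k
    work  : Fin k → Symbol k

  data Move : Set where
    left stay right : Move

  -- inj₂ true is the accepting and inj₂ false the rejecting halting state.
  Control : ℕ → Set
  Control q = Fin q ⊎ Bool

  record Machine : Set where
    field
      #states : ℕ
      #work   : ℕ
      start   : Control #states
      δ       : Fin #states → Symbol #work → Control #states × Symbol #work × Move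

  -- tape ls s rs: the head scans s, ls lists the cells to its left with the
  -- nearest first, rs those to its right; all other cells are blank.
  data Tape (k : ℕ) : Set where
    tape : List (Symbol k) → Symbol k → List (Symbol k) → Tape k

  move : ∀ {k} → Move → Tape k → Tape k
  move left  (tape []       s rs)       = tape [] blank (s ∷ rs)
  move left  (tape (l ∷ ls) s rs)       = tape ls l (s ∷ rs)
  move stay  t                          = t
  move right (tape ls       s [])       = tape (s ∷ ls) blank []
  move right (tape ls       s (r ∷ rs)) = tape (s ∷ ls) r rs

  initial : ∀ {k} → List Input → Tape k
  initial []       = tape [] blank []
  initial (a ∷ as) = tape [] (input a) (map input as)

  module _ (M : Machine) where
    open Machine M

    Config : Set
    Config = Control #states × Tape #work

    data _⟶_ : Config → Config → Set where
      step : ∀ {q ls s rs} →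
             let (c , s′ , m) = δ q s in
             (inj₁ q , tape ls s rs) ⟶ (c , move m (tape ls s′ rs))

    HaltsWith : Bool → List Input → Set
    HaltsWith b w = ∃ λ t → Star _⟶_ (start , initial w) (inj₂ b , t)

    Accepts Rejects : List Input → Set
    Accepts = HaltsWith true
    Rejects = HaltsWith false

record Problem : Set₁ where
  field
    Instance : Set
    code     : Instance → List Token
    Positive : Instance → Set

module _ (P : Problem) where
  open Problem P
  open Turing Token

  -- Nothing is required of the machine on words that code no instance.
  Decides : Machine → Set
  Decides M = ∀ i → (Positive i → Accepts M (code i))
                  × (¬ Positive i → Rejects M (code i))

  Undecidable : Set
  Undecidable = ¬ Σ Machine Decides

restrict : (P : Problem) → (Problem.Instance P → Set) → Problem
restrict P F = record
  { Instance = Σ Instance F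
  ; code     = λ i → code (proj₁ i)
  ; Positive = λ i → Positive (proj₁ i)
  } where open Problem P

------------------------------------------------------------------------
-- The calculi 𝓔 (full) and 𝓔ʳ (relevant)

module BracketFree where

  Formula : Set
  Formula = Fm bracketFree

  data Variant : Set where
    full relevant : Variant

  data HasWeakening : Variant → Set where
    full : HasWeakening full

  infix 3 _⊢_⇒_

  data _⊢_⇒_ (v : Variant) : List Formula → Formula → Set where
    ax  : ∀ {A} → v ⊢ A ∷ [] ⇒ A
    𝟏R  : v ⊢ [] ⇒ 𝟏
    𝟏L  : ∀ {Δ₁ Δ₂ C} → v ⊢ Δ₁ ++ Δ₂ ⇒ C → v ⊢ Δ₁ ++ 𝟏 ∷ Δ₂ ⇒ C
    ∖L  : ∀ {Π Δ₁ Δ₂ A B C} → v ⊢ Π ⇒ A → v ⊢ Δ₁ ++ B ∷ Δ₂ ⇒ C →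
          v ⊢ Δ₁ ++ Π ++ A ∖ B ∷ Δ₂ ⇒ C
    ∖R  : ∀ {Π A B} → v ⊢ A ∷ Π ⇒ B → v ⊢ Π ⇒ A ∖ B
    /L  : ∀ {Π Δ₁ Δ₂ A B C} → v ⊢ Π ⇒ A → v ⊢ Δ₁ ++ B ∷ Δ₂ ⇒ C →
          v ⊢ Δ₁ ++ B / A ∷ Π ++ Δ₂ ⇒ C
    /R  : ∀ {Π A B} → v ⊢ Π ++ A ∷ [] ⇒ B → v ⊢ Π ⇒ B / A
    ·L  : ∀ {Δ₁ Δ₂ A B C} → v ⊢ Δ₁ ++ A ∷ B ∷ Δ₂ ⇒ C → v ⊢ Δ₁ ++ A · B ∷ Δ₂ ⇒ C
    ·R  : ∀ {Π Δ A B} → v ⊢ Π ⇒ A → v ⊢ Δ ⇒ B → v ⊢ Π ++ Δ ⇒ A · B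
    ∧L₁ : ∀ {Δ₁ Δ₂ A B C} → v ⊢ Δ₁ ++ A ∷ Δ₂ ⇒ C → v ⊢ Δ₁ ++ A ∧ B ∷ Δ₂ ⇒ C
    ∧L₂ : ∀ {Δ₁ Δ₂ A B C} → v ⊢ Δ₁ ++ B ∷ Δ₂ ⇒ C → v ⊢ Δ₁ ++ A ∧ B ∷ Δ₂ ⇒ C
    ∧R  : ∀ {Π A B} → v ⊢ Π ⇒ A → v ⊢ Π ⇒ B → v ⊢ Π ⇒ A ∧ B
    ∨L  : ∀ {Δ₁ Δ₂ A B C} → v ⊢ Δ₁ ++ A ∷ Δ₂ ⇒ C → v ⊢ Δ₁ ++ B ∷ Δ₂ ⇒ C →
          v ⊢ Δ₁ ++ A ∨ B ∷ Δ₂ ⇒ C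
    ∨R₁ : ∀ {Π A B} → v ⊢ Π ⇒ A → v ⊢ Π ⇒ A ∨ B
    ∨R₂ : ∀ {Π A B} → v ⊢ Π ⇒ B → v ⊢ Π ⇒ A ∨ B
    !L  : ∀ {Δ₁ Δ₂ A C} → v ⊢ Δ₁ ++ A ∷ Δ₂ ⇒ C → v ⊢ Δ₁ ++ ! A ∷ Δ₂ ⇒ C
    !R  : ∀ {As B} → v ⊢ map !_ As ⇒ B → v ⊢ map !_ As ⇒ ! B
    !P₁ : ∀ {Δ₁ Φ Δ₂ A C} → v ⊢ Δ₁ ++ ! A ∷ Φ ++ Δ₂ ⇒ C → v ⊢ Δ₁ ++ Φ ++ ! A ∷ Δ₂ ⇒ C
    !P₂ : ∀ {Δ₁ Φ Δ₂ A C} → v ⊢ Δ₁ ++ Φ ++ ! A ∷ Δ₂ ⇒ C → v ⊢ Δ₁ ++ ! A ∷ Φ ++ Δ₂ ⇒ C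
    !C  : ∀ {Δ₁ Δ₂ A C} → v ⊢ Δ₁ ++ ! A ∷ ! A ∷ Δ₂ ⇒ C → v ⊢ Δ₁ ++ ! A ∷ Δ₂ ⇒ C
    !W  : ∀ {Δ₁ Δ₂ A C} → HasWeakening v → v ⊢ Δ₁ ++ Δ₂ ⇒ C → v ⊢ Δ₁ ++ ! A ∷ Δ₂ ⇒ C
    cut : ∀ {Π Δ₁ Δ₂ A C} → v ⊢ Π ⇒ A → v ⊢ Δ₁ ++ A ∷ Δ₂ ⇒ C → v ⊢ Δ₁ ++ Π ++ Δ₂ ⇒ C

  derivability : Variant → Problem
  derivability v = record
    { Instance = List Formula × Formula
    ; code     = λ { (Π , A) → codeFms Π ++ arrow ∷ codeFm A }
    ; Positive = λ { (Π , A) → v ⊢ Π ⇒ A }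
    }

  OneDivisionSequent : List Formula × Formula → Set
  OneDivisionSequent (Π , A) = All OneDivision Π × OneDivision A

------------------------------------------------------------------------
-- The calculus 𝓕₂₀₁₅

module StoupFree where

  Formula : Set
  Formula = Fm bracketed

  data Tree : Set where
    fm  : Formula → Tree
    [_] : List Tree → Tree

  Meta : Set
  Meta = List Tree

  data Context : Set where
    □      : Context
    within : Meta → Context → Meta → Context

  infix 8 _⟪_⟫

  _⟪_⟫ : Context → Meta → Meta
  □              ⟪ Θ ⟫ = Θ
  within Γ₁ Ξ Γ₂ ⟪ Θ ⟫ = Γ₁ ++ [ Ξ ⟪ Θ ⟫ ] ∷ Γ₂

  bangs : List Formula → Meta
  bangs = map (λ A → fm (! A))

  infix 3 ⊢_⇒_

  data ⊢_⇒_ : Meta → Formula → Set where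
    ax    : ∀ {A} → ⊢ fm A ∷ [] ⇒ A
    𝟏R    : ⊢ [] ⇒ 𝟏
    𝟏L    : ∀ Ξ {Δ₁ Δ₂ A} → ⊢ Ξ ⟪ Δ₁ ++ Δ₂ ⟫ ⇒ A → ⊢ Ξ ⟪ Δ₁ ++ fm 𝟏 ∷ Δ₂ ⟫ ⇒ A
    /L    : ∀ Ξ {Γ Δ₁ Δ₂ B C D} → ⊢ Γ ⇒ B → ⊢ Ξ ⟪ Δ₁ ++ fm C ∷ Δ₂ ⟫ ⇒ D →
            ⊢ Ξ ⟪ Δ₁ ++ fm (C / B) ∷ Γ ++ Δ₂ ⟫ ⇒ D
    /R    : ∀ {Γ B C} → ⊢ Γ ++ fm B ∷ [] ⇒ C → ⊢ Γ ⇒ C / B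
    ∖L    : ∀ Ξ {Γ Δ₁ Δ₂ A C D} → ⊢ Γ ⇒ A → ⊢ Ξ ⟪ Δ₁ ++ fm C ∷ Δ₂ ⟫ ⇒ D →
            ⊢ Ξ ⟪ Δ₁ ++ Γ ++ fm (A ∖ C) ∷ Δ₂ ⟫ ⇒ D
    ∖R    : ∀ {Γ A C} → ⊢ fm A ∷ Γ ⇒ C → ⊢ Γ ⇒ A ∖ C
    ·L    : ∀ Ξ {Δ₁ Δ₂ A B D} → ⊢ Ξ ⟪ Δ₁ ++ fm A ∷ fm B ∷ Δ₂ ⟫ ⇒ D →
            ⊢ Ξ ⟪ Δ₁ ++ fm (A · B) ∷ Δ₂ ⟫ ⇒ D
    ·R    : ∀ {Δ Γ A B} → ⊢ Δ ⇒ A → ⊢ Γ ⇒ B → ⊢ Δ ++ Γ ⇒ A · B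
    ∧L₁   : ∀ Ξ {Δ₁ Δ₂ A B D} → ⊢ Ξ ⟪ Δ₁ ++ fm A ∷ Δ₂ ⟫ ⇒ D →
            ⊢ Ξ ⟪ Δ₁ ++ fm (A ∧ B) ∷ Δ₂ ⟫ ⇒ D
    ∧L₂   : ∀ Ξ {Δ₁ Δ₂ A B D} → ⊢ Ξ ⟪ Δ₁ ++ fm B ∷ Δ₂ ⟫ ⇒ D →
            ⊢ Ξ ⟪ Δ₁ ++ fm (A ∧ B) ∷ Δ₂ ⟫ ⇒ D
    ∧R    : ∀ {Ξ A B} → ⊢ Ξ ⇒ A → ⊢ Ξ ⇒ B → ⊢ Ξ ⇒ A ∧ B
    ∨L    : ∀ Ξ {Δ₁ Δ₂ A B D} → ⊢ Ξ ⟪ Δ₁ ++ fm A ∷ Δ₂ ⟫ ⇒ D →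
            ⊢ Ξ ⟪ Δ₁ ++ fm B ∷ Δ₂ ⟫ ⇒ D → ⊢ Ξ ⟪ Δ₁ ++ fm (A ∨ B) ∷ Δ₂ ⟫ ⇒ D
    ∨R₁   : ∀ {Ξ A B} → ⊢ Ξ ⇒ A → ⊢ Ξ ⇒ A ∨ B
    ∨R₂   : ∀ {Ξ A B} → ⊢ Ξ ⇒ B → ⊢ Ξ ⇒ A ∨ B
    []⁻¹L : ∀ Ξ {Δ₁ Δ₂ A B} → ⊢ Ξ ⟪ Δ₁ ++ fm A ∷ Δ₂ ⟫ ⇒ B →
            ⊢ Ξ ⟪ Δ₁ ++ [ fm ([]⁻¹ A) ∷ [] ] ∷ Δ₂ ⟫ ⇒ B
    []⁻¹R : ∀ {Ξ A} → ⊢ [ Ξ ] ∷ [] ⇒ A → ⊢ Ξ ⇒ []⁻¹ A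
    ⟨⟩L   : ∀ Ξ {Δ₁ Δ₂ A B} → ⊢ Ξ ⟪ Δ₁ ++ [ fm A ∷ [] ] ∷ Δ₂ ⟫ ⇒ B →
            ⊢ Ξ ⟪ Δ₁ ++ fm (⟨⟩ A) ∷ Δ₂ ⟫ ⇒ B
    ⟨⟩R   : ∀ {Ξ A} → ⊢ Ξ ⇒ A → ⊢ [ Ξ ] ∷ [] ⇒ ⟨⟩ A
    !L    : ∀ Ξ {Δ₁ Δ₂ A C} → ⊢ Ξ ⟪ Δ₁ ++ fm A ∷ Δ₂ ⟫ ⇒ C →
            ⊢ Ξ ⟪ Δ₁ ++ fm (! A) ∷ Δ₂ ⟫ ⇒ C
    !R    : ∀ {As B} → As ≢ [] → ⊢ bangs As ⇒ B → ⊢ bangs As ⇒ ! B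
    !P₁   : ∀ Ξ {Δ₁ Φ Δ₂ A C} → ⊢ Ξ ⟪ Δ₁ ++ fm (! A) ∷ Φ ++ Δ₂ ⟫ ⇒ C →
            ⊢ Ξ ⟪ Δ₁ ++ Φ ++ fm (! A) ∷ Δ₂ ⟫ ⇒ C
    !P₂   : ∀ Ξ {Δ₁ Φ Δ₂ A C} → ⊢ Ξ ⟪ Δ₁ ++ Φ ++ fm (! A) ∷ Δ₂ ⟫ ⇒ C →
            ⊢ Ξ ⟪ Δ₁ ++ fm (! A) ∷ Φ ++ Δ₂ ⟫ ⇒ C
    !C    : ∀ Ξ {As Γ₁ Γ₂ Γ₃ C} → As ≢ [] →
            ⊢ Ξ ⟪ bangs As ++ Γ₁ ++ [ bangs As ++ Γ₂ ] ∷ Γ₃ ⟫ ⇒ C →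
            ⊢ Ξ ⟪ bangs As ++ Γ₁ ++ Γ₂ ++ Γ₃ ⟫ ⇒ C
    cut   : ∀ Ξ {Π Γ₁ Γ₂ A C} → ⊢ Π ⇒ A → ⊢ Ξ ⟪ Γ₁ ++ fm A ∷ Γ₂ ⟫ ⇒ C →
            ⊢ Ξ ⟪ Γ₁ ++ Π ++ Γ₂ ⟫ ⇒ C

  codeTree : Tree → List Token
  codeMeta : Meta → List Token
  codeTree (fm A)  = codeFm A
  codeTree [ Ξ ]   = open[ ∷ codeMeta Ξ ++ close] ∷ []
  codeMeta []      = []
  codeMeta (T ∷ Γ) = codeTree T ++ codeMeta Γ

  derivability : Problem
  derivability = record
    { Instance = Meta × Formula
    ; code     = λ { (Ξ , A) → codeMeta Ξ ++ arrow ∷ codeFm A }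
    ; Positive = λ { (Ξ , A) → ⊢ Ξ ⇒ A }
    }

  data OneDivisionTree : Tree → Set where
    fm  : ∀ {A} → OneDivision A → OneDivisionTree (fm A)
    [_] : ∀ {Ξ} → All OneDivisionTree Ξ → OneDivisionTree [ Ξ ]

  OneDivisionSequent : Meta × Formula → Set
  OneDivisionSequent (Ξ , A) = All OneDivisionTree Ξ × OneDivision A

------------------------------------------------------------------------
-- The calculi 𝓜₂₀₁₅ (plain) and 𝓜′₂₀₁₅ (primed)

module Stoup where

  Formula : Set
  Formula = Fm bracketed

  infix 4 _⨾_

  -- Stoups are lists; the rule perm below makes them multisets.
  data Tree : Set
  data Meta : Set

  data Tree where
    fm  : Formula → Tree
    [_] : Meta → Tree

  data Meta where
    _⨾_ : List Formula → List Tree → Meta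

  data Context : Set where
    □      : Context
    within : List Formula → List Tree → Context → List Tree → Context

  infix 8 _⟪_⟫

  _⟪_⟫ : Context → Meta → Meta
  □                ⟪ Θ ⟫ = Θ
  within ζ Γ₁ Ξ Γ₂ ⟪ Θ ⟫ = ζ ⨾ Γ₁ ++ [ Ξ ⟪ Θ ⟫ ] ∷ Γ₂

  data Variant : Set where
    plain primed : Variant

  infix 3 _⊢_⇒_

  data _⊢_⇒_ : Variant → Meta → Formula → Set where
    -- Replaces the identification of stoups that are equal as multisets.
    perm  : ∀ {v} Ξ {ζ ζ′ Γ C} → ζ ↭ ζ′ → v ⊢ Ξ ⟪ ζ ⨾ Γ ⟫ ⇒ C → v ⊢ Ξ ⟪ ζ′ ⨾ Γ ⟫ ⇒ C

    ax    : ∀ {v A} → v ⊢ [] ⨾ fm A ∷ [] ⇒ A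
    𝟏R    : ∀ {v} → v ⊢ [] ⨾ [] ⇒ 𝟏
    𝟏L    : ∀ {v} Ξ {ζ Δ₁ Δ₂ A} → v ⊢ Ξ ⟪ ζ ⨾ Δ₁ ++ Δ₂ ⟫ ⇒ A →
            v ⊢ Ξ ⟪ ζ ⨾ Δ₁ ++ fm 𝟏 ∷ Δ₂ ⟫ ⇒ A
    /L    : ∀ {v} Ξ {ζ₁ ζ₂ Γ Δ₁ Δ₂ B C D} → v ⊢ ζ₁ ⨾ Γ ⇒ B →
            v ⊢ Ξ ⟪ ζ₂ ⨾ Δ₁ ++ fm C ∷ Δ₂ ⟫ ⇒ D →
            v ⊢ Ξ ⟪ ζ₁ ++ ζ₂ ⨾ Δ₁ ++ fm (C / B) ∷ Γ ++ Δ₂ ⟫ ⇒ D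
    /R    : ∀ {v ζ Γ B C} → v ⊢ ζ ⨾ Γ ++ fm B ∷ [] ⇒ C → v ⊢ ζ ⨾ Γ ⇒ C / B
    ∖L    : ∀ {v} Ξ {ζ₁ ζ₂ Γ Δ₁ Δ₂ A C D} → v ⊢ ζ₁ ⨾ Γ ⇒ A →
            v ⊢ Ξ ⟪ ζ₂ ⨾ Δ₁ ++ fm C ∷ Δ₂ ⟫ ⇒ D →
            v ⊢ Ξ ⟪ ζ₁ ++ ζ₂ ⨾ Δ₁ ++ Γ ++ fm (A ∖ C) ∷ Δ₂ ⟫ ⇒ D
    ∖R    : ∀ {v ζ Γ A C} → v ⊢ ζ ⨾ fm A ∷ Γ ⇒ C → v ⊢ ζ ⨾ Γ ⇒ A ∖ C
    ·L    : ∀ {v} Ξ {ζ Δ₁ Δ₂ A B D} → v ⊢ Ξ ⟪ ζ ⨾ Δ₁ ++ fm A ∷ fm B ∷ Δ₂ ⟫ ⇒ D →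
            v ⊢ Ξ ⟪ ζ ⨾ Δ₁ ++ fm (A · B) ∷ Δ₂ ⟫ ⇒ D
    ·R    : ∀ {v ζ₁ ζ₂ Δ Γ A B} → v ⊢ ζ₁ ⨾ Δ ⇒ A → v ⊢ ζ₂ ⨾ Γ ⇒ B →
            v ⊢ ζ₁ ++ ζ₂ ⨾ Δ ++ Γ ⇒ A · B
    ∧L₁   : ∀ {v} Ξ {ζ Δ₁ Δ₂ A B D} → v ⊢ Ξ ⟪ ζ ⨾ Δ₁ ++ fm A ∷ Δ₂ ⟫ ⇒ D →
            v ⊢ Ξ ⟪ ζ ⨾ Δ₁ ++ fm (A ∧ B) ∷ Δ₂ ⟫ ⇒ D
    ∧L₂   : ∀ {v} Ξ {ζ Δ₁ Δ₂ A B D} → v ⊢ Ξ ⟪ ζ ⨾ Δ₁ ++ fm B ∷ Δ₂ ⟫ ⇒ D →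
            v ⊢ Ξ ⟪ ζ ⨾ Δ₁ ++ fm (A ∧ B) ∷ Δ₂ ⟫ ⇒ D
    ∧R    : ∀ {v Ξ A B} → v ⊢ Ξ ⇒ A → v ⊢ Ξ ⇒ B → v ⊢ Ξ ⇒ A ∧ B
    ∨L    : ∀ {v} Ξ {ζ Δ₁ Δ₂ A B D} → v ⊢ Ξ ⟪ ζ ⨾ Δ₁ ++ fm A ∷ Δ₂ ⟫ ⇒ D →
            v ⊢ Ξ ⟪ ζ ⨾ Δ₁ ++ fm B ∷ Δ₂ ⟫ ⇒ D →
            v ⊢ Ξ ⟪ ζ ⨾ Δ₁ ++ fm (A ∨ B) ∷ Δ₂ ⟫ ⇒ D
    ∨R₁   : ∀ {v Ξ A B} → v ⊢ Ξ ⇒ A → v ⊢ Ξ ⇒ A ∨ B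
    ∨R₂   : ∀ {v Ξ A B} → v ⊢ Ξ ⇒ B → v ⊢ Ξ ⇒ A ∨ B
    []⁻¹L : ∀ {v} Ξ {ζ Δ₁ Δ₂ A B} → v ⊢ Ξ ⟪ ζ ⨾ Δ₁ ++ fm A ∷ Δ₂ ⟫ ⇒ B →
            v ⊢ Ξ ⟪ ζ ⨾ Δ₁ ++ [ [] ⨾ fm ([]⁻¹ A) ∷ [] ] ∷ Δ₂ ⟫ ⇒ B
    []⁻¹R : ∀ {v Ξ A} → v ⊢ [] ⨾ [ Ξ ] ∷ [] ⇒ A → v ⊢ Ξ ⇒ []⁻¹ A
    ⟨⟩L   : ∀ {v} Ξ {ζ Δ₁ Δ₂ A B} → v ⊢ Ξ ⟪ ζ ⨾ Δ₁ ++ [ [] ⨾ fm A ∷ [] ] ∷ Δ₂ ⟫ ⇒ B →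
            v ⊢ Ξ ⟪ ζ ⨾ Δ₁ ++ fm (⟨⟩ A) ∷ Δ₂ ⟫ ⇒ B
    ⟨⟩R   : ∀ {v Ξ A} → v ⊢ Ξ ⇒ A → v ⊢ [] ⨾ [ Ξ ] ∷ [] ⇒ ⟨⟩ A
    !L    : ∀ {v} Ξ {ζ Γ₁ Γ₂ A B} → v ⊢ Ξ ⟪ ζ ++ A ∷ [] ⨾ Γ₁ ++ Γ₂ ⟫ ⇒ B →
            v ⊢ Ξ ⟪ ζ ⨾ Γ₁ ++ fm (! A) ∷ Γ₂ ⟫ ⇒ B
    !P    : ∀ {v} Ξ {ζ Γ₁ Γ₂ A B} → v ⊢ Ξ ⟪ ζ ⨾ Γ₁ ++ fm A ∷ Γ₂ ⟫ ⇒ B →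
            v ⊢ Ξ ⟪ ζ ++ A ∷ [] ⨾ Γ₁ ++ Γ₂ ⟫ ⇒ B

    !R    : ∀ {ζ B} → plain ⊢ ζ ⨾ [] ⇒ B → plain ⊢ ζ ⨾ [] ⇒ ! B
    !C    : ∀ Ξ {ζ₁ ζ₂ Γ₁ Γ₂ Γ₃ B} → ζ₂ ≢ [] →
            plain ⊢ Ξ ⟪ ζ₁ ++ ζ₂ ⨾ Γ₁ ++ [ ζ₂ ⨾ Γ₂ ] ∷ Γ₃ ⟫ ⇒ B →
            plain ⊢ Ξ ⟪ ζ₁ ++ ζ₂ ⨾ Γ₁ ++ Γ₂ ++ Γ₃ ⟫ ⇒ B

    !R′   : ∀ {ζ B} → ζ ≢ [] → primed ⊢ ζ ⨾ [] ⇒ B → primed ⊢ ζ ⨾ [] ⇒ ! B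
    !C′   : ∀ Ξ {ζ₁ ζ₂ ζ′ Γ₁ Γ₂ Γ₃ C} → ζ₂ ≢ [] →
            primed ⊢ Ξ ⟪ ζ₁ ++ ζ₂ ⨾ Γ₁ ++ [ ζ′ ++ ζ₂ ⨾ Γ₂ ] ∷ Γ₃ ⟫ ⇒ C →
            primed ⊢ Ξ ⟪ ζ₁ ++ ζ₂ ++ ζ′ ⨾ Γ₁ ++ Γ₂ ++ Γ₃ ⟫ ⇒ C

  codeTree  : Tree → List Token
  codeTrees : List Tree → List Token
  codeMeta  : Meta → List Token
  codeTree (fm A)   = codeFm A
  codeTree [ Ξ ]    = open[ ∷ codeMeta Ξ ++ close] ∷ []
  codeTrees []      = []
  codeTrees (T ∷ Γ) = codeTree T ++ codeTrees Γ
  codeMeta (ζ ⨾ Γ)  = codeFms ζ ++ semicolon ∷ codeTrees Γ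

  derivability : Variant → Problem
  derivability v = record
    { Instance = Meta × Formula
    ; code     = λ { (Ξ , A) → codeMeta Ξ ++ arrow ∷ codeFm A }
    ; Positive = λ { (Ξ , A) → v ⊢ Ξ ⇒ A }
    }

  data OneDivisionTree : Tree → Set
  data OneDivisionMeta : Meta → Set

  data OneDivisionTree where
    fm  : ∀ {A} → OneDivision A → OneDivisionTree (fm A)
    [_] : ∀ {Ξ} → OneDivisionMeta Ξ → OneDivisionTree [ Ξ ]

  data OneDivisionMeta where
    _⨾_ : ∀ {ζ Γ} → All OneDivision ζ → All OneDivisionTree Γ → OneDivisionMeta (ζ ⨾ Γ)

  OneDivisionSequent : Meta × Formula → Set
  OneDivisionSequent (Ξ , A) = OneDivisionMeta Ξ × OneDivision A

------------------------------------------------------------------------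
-- Derivability in the one-division fragments

𝓔-OneDivision 𝓔ʳ-OneDivision 𝓕₂₀₁₅-OneDivision : Problem
𝓜′₂₀₁₅-OneDivision 𝓜₂₀₁₅-OneDivision : Problem
𝓔-OneDivision      = restrict (BracketFree.derivability BracketFree.full) BracketFree.OneDivisionSequent
𝓔ʳ-OneDivision     = restrict (BracketFree.derivability BracketFree.relevant) BracketFree.OneDivisionSequent
𝓕₂₀₁₅-OneDivision  = restrict StoupFree.derivability StoupFree.OneDivisionSequent
𝓜′₂₀₁₅-OneDivision = restrict (Stoup.derivability Stoup.primed) Stoup.OneDivisionSequent
𝓜₂₀₁₅-OneDivision  = restrict (Stoup.derivability Stoup.plain) Stoup.OneDivisionSequent

{-# OPTIONS --safe #-}
module Submission where

open import Data.Bool using (Bool; true; false)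
open import Data.Fin using (Fin; #_; toℕ)
open import Data.Fin.Properties using (toℕ-injective)
open import Data.List using (List; []; _∷_; _++_; map; concatMap; lookup; reverse; allFin; cartesianProductWith)
open import Data.List.Membership.Propositional using (_∈_; lose)
open import Data.List.Membership.Propositional.Properties
  using (∈-map⁺; ∈-map⁻; ∈-++⁺ˡ; ∈-++⁺ʳ; ∈-∃++; ∈-concatMap⁺; ∈-concatMap⁻; ∈-cartesianProductWith⁺; ∈-allFin; ∈-lookup)
open import Data.List.Properties
  using (++-assoc; ++-identityʳ; ++-cancelˡ; ++-monoid; map-++; map-∘; concatMap-++; concatMap-map; unfold-reverse)
open import Data.List.Relation.Binary.Permutation.Propositional using (_↭_; ↭-sym; ↭-trans)
open import Data.List.Relation.Binary.Permutation.Propositional.Properties using (All-resp-↭; ++-comm; shift)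
open import Data.List.Relation.Unary.All using (All; []; _∷_)
open import Data.List.Relation.Unary.All.Properties using (++⁺; ++⁻)
open import Data.List.Relation.Unary.Any using (here; there; index; satisfied)
open import Data.List.Relation.Unary.Any.Properties using (lookup-index)
open import Data.Nat using (ℕ)
open import Data.Product using (∃; ∃₂; _×_; _,_; proj₁; proj₂; map₁; map₂)
open import Data.Sum using (_⊎_; inj₁; inj₂)
open import Defs hiding (tick; x; one; under; over; times; and; or; bang; dia; box; semicolon; arrow)
open import Function using (_∘_)
open import Level using (0ℓ)
open import Relation.Binary.Construct.Closure.ReflexiveTransitive using (Star; ε; _◅_; _◅◅_)
open import Relation.Binary.Core using (Rel; _⇒_)
open import Relation.Binary.Definitions using (Reflexive; Transitive)
open import Relation.Binary.PropositionalEquality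
  using (_≡_; refl; sym; trans; cong; cong₂; subst; subst₂; module ≡-Reasoning)
open import Relation.Nullary using (¬_; contradiction)
open import Tactic.MonoidSolver using (solve)
import Data.List.Relation.Unary.All as All
import Data.List.Relation.Unary.All.Properties as AllP

-- A configuration of a machine with one queue becomes a sequent: the state is
-- the succedent, the queue is the antecedent. Under !, the formula
-- (q / (((r / bₖ) / …) / b₁)) / a removes a from the left end of the
-- antecedent, appends b₁ … bₖ at its right end (by /R), and replaces the
-- succedent q by r. So a computation ending in state h is a derivation; the
-- leftover copies of the formulae are consumed by companions (h / h) / A.
-- Conversely, the calculi are sound for interpretations of formulae by
-- relations between words, in which q holds of the queues from which the
-- machine in state q reaches h.
--
-- Against a Turing machine M claimed to be a decider we take a queue machine
-- that first expands its queue into the code of the very sequent that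
-- describes it, then simulates M on this code, and reaches h exactly if M
-- rejects: the queue holds the part of the code that precedes the queue itself,
-- one letter for each token, and from it both that part and the code of the
-- queue can be recovered. Determinism of the queue machine refutes M if it accepts.

-- Composition of relations along a list.

data Chain {P T : Set} (I : T → Rel P 0ℓ) : List T → Rel P 0ℓ where
  []  : ∀ {s} → Chain I [] s s
  _∷_ : ∀ {x xs s m t} → I x s m → Chain I xs m t → Chain I (x ∷ xs) s t

module _ {P T : Set} {I : T → Rel P 0ℓ} where

  infixr 5 _⊕_

  _⊕_ : ∀ {xs ys s m t} → Chain I xs s m → Chain I ys m t → Chain I (xs ++ ys) s t
  []      ⊕ d = d
  (i ∷ c) ⊕ d = i ∷ (c ⊕ d)

  split : ∀ xs {ys s t} → Chain I (xs ++ ys) s t → ∃ λ m → Chain I xs s m × Chain I ys m t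
  split []       c       = _ , [] , c
  split (_ ∷ xs) (i ∷ c) = map₂ (map₁ (i ∷_)) (split xs c)

  focus : ∀ xs {y ys s t} → Chain I (xs ++ y ∷ ys) s t →
          ∃₂ λ m n → Chain I xs s m × I y m n × Chain I ys n t
  focus xs c with split xs c
  ... | m , p , i ∷ q = m , _ , p , i , q

  after : ∀ xs {ys zs} → Chain I ys ⇒ Chain I zs → Chain I (xs ++ ys) ⇒ Chain I (xs ++ zs)
  after xs f c = let _ , p , q = split xs c in p ⊕ f q

  chain-⇒ : ∀ {_≼_ : Rel P 0ℓ} → Reflexive _≼_ → Transitive _≼_ → (∀ x → I x ⇒ _≼_) →
            ∀ {xs} → Chain I xs ⇒ _≼_
  chain-⇒ ≼-refl ≼-trans f []      = ≼-refl
  chain-⇒ ≼-refl ≼-trans f (i ∷ c) = ≼-trans (f _ i) (chain-⇒ ≼-refl ≼-trans f c)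

-- Relational model and soundness of the calculi.

-- Brackets are erased, and ! A is the identity if A contains the identity and
-- empty otherwise, so that the structural rules for ! are sound, weakening
-- included. The divisions are restricted to ≼ because a quotient could otherwise
-- relate a position to an earlier one.
module Model {P : Set} (_≼_ : Rel P 0ℓ) (≼-refl : Reflexive _≼_) (≼-trans : Transitive _≼_)
             (V : ℕ → Rel P 0ℓ) (V⇒≼ : ∀ n → V n ⇒ _≼_) where

  mutual
    ⟦_⟧ : ∀ {ℓ} → Fm ℓ → Rel P 0ℓ
    ⟦ var n ⟧  s t = V n s t
    ⟦ 𝟏 ⟧      s t = s ≡ t
    ⟦ A ∖ B ⟧  s t = s ≼ t × (∀ r → ⟦ A ⟧ r s → ⟦ B ⟧ r t)
    ⟦ B / A ⟧  s t = s ≼ t × (∀ u → ⟦ A ⟧ t u → ⟦ B ⟧ s u)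
    ⟦ A · B ⟧  s t = ∃ λ m → ⟦ A ⟧ s m × ⟦ B ⟧ m t
    ⟦ A ∧ B ⟧  s t = ⟦ A ⟧ s t × ⟦ B ⟧ s t
    ⟦ A ∨ B ⟧  s t = ⟦ A ⟧ s t ⊎ ⟦ B ⟧ s t
    ⟦ ! A ⟧    s t = s ≡ t × Valid A
    ⟦ ⟨⟩ A ⟧   s t = ⟦ A ⟧ s t
    ⟦ []⁻¹ A ⟧ s t = ⟦ A ⟧ s t

    Valid : ∀ {ℓ} → Fm ℓ → Set
    Valid A = ∀ s → ⟦ A ⟧ s s

  -- The divisions carry this bound by definition, so their right rules need it for whole
  -- antecedents.
  ⟦⟧⇒≼ : ∀ {ℓ} (A : Fm ℓ) → ⟦ A ⟧ ⇒ _≼_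
  ⟦⟧⇒≼ (var n)  a              = V⇒≼ n a
  ⟦⟧⇒≼ 𝟏        refl           = ≼-refl
  ⟦⟧⇒≼ (A ∖ B)  (s≼t , _)      = s≼t
  ⟦⟧⇒≼ (B / A)  (s≼t , _)      = s≼t
  ⟦⟧⇒≼ (A · B)  (_ , a , b)    = ≼-trans (⟦⟧⇒≼ A a) (⟦⟧⇒≼ B b)
  ⟦⟧⇒≼ (A ∧ B)  (a , _)        = ⟦⟧⇒≼ A a
  ⟦⟧⇒≼ (A ∨ B)  (inj₁ a)       = ⟦⟧⇒≼ A a
  ⟦⟧⇒≼ (A ∨ B)  (inj₂ b)       = ⟦⟧⇒≼ B b
  ⟦⟧⇒≼ (! A)    (refl , _)     = ≼-refl
  ⟦⟧⇒≼ (⟨⟩ A)   a              = ⟦⟧⇒≼ A a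
  ⟦⟧⇒≼ ([]⁻¹ A) a              = ⟦⟧⇒≼ A a

  module BracketFreeSoundness where
    open BracketFree

    private
      C : List Formula → Rel P 0ℓ
      C = Chain (⟦_⟧ {bracketFree})

      chain-≼ : ∀ {Π} → C Π ⇒ _≼_
      chain-≼ = chain-⇒ ≼-refl ≼-trans ⟦⟧⇒≼

    valid-bangs : (As : List Formula) → All Valid As → ∀ {s} → C (map !_ As) s s
    valid-bangs []       []       = []
    valid-bangs (A ∷ As) (v ∷ vs) = (refl , v) ∷ valid-bangs As vs

    -- `! A` moves nothing and stores `Valid A`, a fact independent of the point. Hence `!R` can
    -- replay its premise at every point.
    bangs-valid : (As : List Formula) → ∀ {s t} → C (map !_ As) s t → s ≡ t × All Valid As
    bangs-valid []       []               = refl , []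
    bangs-valid (A ∷ As) ((refl , v) ∷ c) = map₂ (v ∷_) (bangs-valid As c)

    private
      divide : ∀ Π {A B Δ} → C Π ⇒ ⟦ A ⟧ → C (Π ++ A ∖ B ∷ Δ) ⇒ C (B ∷ Δ)
      divide Π a c with focus Π c
      ... | _ , _ , p , (_ , f) , q = f _ (a p) ∷ q

      float : ∀ Φ {A Δ} → C (Φ ++ ! A ∷ Δ) ⇒ C (! A ∷ Φ ++ Δ)
      float Φ c with focus Φ c
      ... | _ , _ , p , (refl , v) , q = (refl , v) ∷ p ⊕ q

    sound : ∀ {v Π A} → v ⊢ Π ⇒ A → C Π ⇒ ⟦ A ⟧
    sound ax (a ∷ []) = a
    sound 𝟏R [] = refl
    sound (𝟏L {Δ₁} d) = sound d ∘ after Δ₁ λ { (refl ∷ c) → c }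
    sound (∖L {Π} {Δ₁} d e) = sound e ∘ after Δ₁ (divide Π (sound d))
    sound (∖R d) c = chain-≼ c , λ _ a → sound d (a ∷ c)
    sound (/L {Π} {Δ₁} d e) = sound e ∘ after Δ₁ λ { ((_ , f) ∷ c) →
      let _ , p , q = split Π c in f _ (sound d p) ∷ q }
    sound (/R d) c = chain-≼ c , λ _ a → sound d (c ⊕ a ∷ [])
    sound (·L {Δ₁} d) = sound d ∘ after Δ₁ λ { ((_ , a , b) ∷ c) → a ∷ b ∷ c }
    sound (·R {Π} d e) c = let _ , p , q = split Π c in _ , sound d p , sound e q
    sound (∧L₁ {Δ₁} d) = sound d ∘ after Δ₁ λ { ((a , _) ∷ c) → a ∷ c }
    sound (∧L₂ {Δ₁} d) = sound d ∘ after Δ₁ λ { ((_ , b) ∷ c) → b ∷ c }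
    sound (∧R d e) c = sound d c , sound e c
    sound (∨L {Δ₁} d e) c with focus Δ₁ c
    ... | _ , _ , p , inj₁ a , q = sound d (p ⊕ a ∷ q)
    ... | _ , _ , p , inj₂ b , q = sound e (p ⊕ b ∷ q)
    sound (∨R₁ d) = inj₁ ∘ sound d
    sound (∨R₂ d) = inj₂ ∘ sound d
    sound (!L {Δ₁} d) = sound d ∘ after Δ₁ λ { ((refl , v) ∷ c) → v _ ∷ c }
    sound (!R {As} d) c = let eq , vs = bangs-valid As c in eq , λ _ → sound d (valid-bangs As vs)
    sound (!P₁ {Δ₁} {Φ} d) = sound d ∘ after Δ₁ (float Φ)
    sound (!P₂ {Δ₁} {Φ} d) = sound d ∘ after Δ₁ λ { ((refl , v) ∷ c) →
      let _ , p , q = split Φ c in p ⊕ (refl , v) ∷ q }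
    sound (!C {Δ₁} d) = sound d ∘ after Δ₁ λ { ((refl , v) ∷ c) → (refl , v) ∷ (refl , v) ∷ c }
    sound (!W {Δ₁} _ d) = sound d ∘ after Δ₁ λ { ((refl , _) ∷ c) → c }
    sound (cut {Π} {Δ₁} d e) = sound e ∘ after Δ₁ λ c →
      let _ , p , q = split Π c in sound d p ∷ q

  module StoupFreeSoundness where
    open StoupFree

    data ⟦_⟧ᵗ : Tree → Rel P 0ℓ where
      fm  : ∀ {A s t} → ⟦ A ⟧ s t → ⟦ fm A ⟧ᵗ s t
      [_] : ∀ {Ξ s t} → Chain ⟦_⟧ᵗ Ξ s t → ⟦ [ Ξ ] ⟧ᵗ s t

    private
      C : Meta → Rel P 0ℓ
      C = Chain ⟦_⟧ᵗ

      chain-≼ : ∀ {Γ} → C Γ ⇒ _≼_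
      chain-≼ []                    = ≼-refl
      chain-≼ {fm A ∷ _} (fm a ∷ c) = ≼-trans (⟦⟧⇒≼ A a) (chain-≼ c)
      chain-≼ ([ b ] ∷ c)           = ≼-trans (chain-≼ b) (chain-≼ c)

      -- Contexts are compositions, hence monotone in the hole; most left rules thus reduce to an
      -- inclusion at the hole.
      inside : ∀ Ξ {Θ Θ′} → C Θ ⇒ C Θ′ → C (Ξ ⟪ Θ ⟫) ⇒ C (Ξ ⟪ Θ′ ⟫)
      inside □               f = f
      inside (within Γ₁ Ξ _) f = after Γ₁ λ { ([ b ] ∷ c) → [ inside Ξ f b ] ∷ c }

      at : ∀ Ξ Δ₁ {Δ Δ′} → C Δ ⇒ C Δ′ → C (Ξ ⟪ Δ₁ ++ Δ ⟫) ⇒ C (Ξ ⟪ Δ₁ ++ Δ′ ⟫)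
      at Ξ Δ₁ f = inside Ξ (after Δ₁ f)

    valid-bangs : ∀ As → All Valid As → ∀ {s} → C (bangs As) s s
    valid-bangs []       []       = []
    valid-bangs (A ∷ As) (v ∷ vs) = fm (refl , v) ∷ valid-bangs As vs

    bangs-valid : ∀ As {s t} → C (bangs As) s t → s ≡ t × All Valid As
    bangs-valid []       []                  = refl , []
    bangs-valid (A ∷ As) (fm (refl , v) ∷ c) = map₂ (v ∷_) (bangs-valid As c)

    private
      -- Monotonicity does not suffice for `∨L`, which has two premises over one context: the
      -- disjunct found at the hole decides which of them applies.
      distinguish : ∀ Ξ Δ₁ {A B Δ₂ s t} → C (Ξ ⟪ Δ₁ ++ fm (A ∨ B) ∷ Δ₂ ⟫) s t →
                    C (Ξ ⟪ Δ₁ ++ fm A ∷ Δ₂ ⟫) s t ⊎ C (Ξ ⟪ Δ₁ ++ fm B ∷ Δ₂ ⟫) s t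
      distinguish □ Δ₁ c with focus Δ₁ c
      ... | _ , _ , p , fm (inj₁ a) , q = inj₁ (p ⊕ fm a ∷ q)
      ... | _ , _ , p , fm (inj₂ b) , q = inj₂ (p ⊕ fm b ∷ q)
      distinguish (within Γ₁ Ξ Γ₂) Δ₁ c with focus Γ₁ c
      ... | _ , _ , p , [ b ] , q with distinguish Ξ Δ₁ b
      ... | inj₁ b₁ = inj₁ (p ⊕ [ b₁ ] ∷ q)
      ... | inj₂ b₂ = inj₂ (p ⊕ [ b₂ ] ∷ q)

      divide : ∀ Γ {A B Δ} → C Γ ⇒ ⟦ A ⟧ → C (Γ ++ fm (A ∖ B) ∷ Δ) ⇒ C (fm B ∷ Δ)
      divide Γ a c with focus Γ c
      ... | _ , _ , p , fm (_ , f) , q = fm (f _ (a p)) ∷ q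

      float : ∀ Φ {A Δ} → C (Φ ++ fm (! A) ∷ Δ) ⇒ C (fm (! A) ∷ Φ ++ Δ)
      float Φ c with focus Φ c
      ... | _ , _ , p , fm (refl , v) , q = fm (refl , v) ∷ p ⊕ q

      -- The copies inside the bracket sit after `Γ₁`; validity, being independent of the point,
      -- supplies them there.
      contract : ∀ As Γ₁ Γ₂ {Γ₃} →
                 C (bangs As ++ Γ₁ ++ Γ₂ ++ Γ₃) ⇒ C (bangs As ++ Γ₁ ++ [ bangs As ++ Γ₂ ] ∷ Γ₃)
      contract As Γ₁ Γ₂ c with split (bangs As) c
      ... | _ , b , c′ with split Γ₁ c′
      ... | _ , p , c″ with split Γ₂ c″
      ... | _ , q , r = b ⊕ p ⊕ [ valid-bangs As (proj₂ (bangs-valid As b)) ⊕ q ] ∷ r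

    sound : ∀ {Γ A} → ⊢ Γ ⇒ A → C Γ ⇒ ⟦ A ⟧
    sound ax (fm a ∷ []) = a
    sound 𝟏R [] = refl
    sound (𝟏L Ξ {Δ₁} d) = sound d ∘ at Ξ Δ₁ λ { (fm refl ∷ c) → c }
    sound (/L Ξ {Γ} {Δ₁} d e) = sound e ∘ at Ξ Δ₁ λ { (fm (_ , f) ∷ c) →
      let _ , p , q = split Γ c in fm (f _ (sound d p)) ∷ q }
    sound (/R d) c = chain-≼ c , λ _ a → sound d (c ⊕ fm a ∷ [])
    sound (∖L Ξ {Γ} {Δ₁} d e) = sound e ∘ at Ξ Δ₁ (divide Γ (sound d))
    sound (∖R d) c = chain-≼ c , λ _ a → sound d (fm a ∷ c)
    sound (·L Ξ {Δ₁} d) = sound d ∘ at Ξ Δ₁ λ { (fm (_ , a , b) ∷ c) → fm a ∷ fm b ∷ c }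
    sound (·R {Δ} d e) c = let _ , p , q = split Δ c in _ , sound d p , sound e q
    sound (∧L₁ Ξ {Δ₁} d) = sound d ∘ at Ξ Δ₁ λ { (fm (a , _) ∷ c) → fm a ∷ c }
    sound (∧L₂ Ξ {Δ₁} d) = sound d ∘ at Ξ Δ₁ λ { (fm (_ , b) ∷ c) → fm b ∷ c }
    sound (∧R d e) c = sound d c , sound e c
    sound (∨L Ξ {Δ₁} d e) c with distinguish Ξ Δ₁ c
    ... | inj₁ c₁ = sound d c₁
    ... | inj₂ c₂ = sound e c₂
    sound (∨R₁ d) = inj₁ ∘ sound d
    sound (∨R₂ d) = inj₂ ∘ sound d
    sound ([]⁻¹L Ξ {Δ₁} d) = sound d ∘ at Ξ Δ₁ λ { ([ fm a ∷ [] ] ∷ c) → fm a ∷ c }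
    sound ([]⁻¹R d) c = sound d ([ c ] ∷ [])
    sound (⟨⟩L Ξ {Δ₁} d) = sound d ∘ at Ξ Δ₁ λ { (fm a ∷ c) → [ fm a ∷ [] ] ∷ c }
    sound (⟨⟩R d) ([ c ] ∷ []) = sound d c
    sound (!L Ξ {Δ₁} d) = sound d ∘ at Ξ Δ₁ λ { (fm (refl , v) ∷ c) → fm (v _) ∷ c }
    sound (!R {As} _ d) c = let eq , vs = bangs-valid As c in eq , λ _ → sound d (valid-bangs As vs)
    sound (!P₁ Ξ {Δ₁} {Φ} d) = sound d ∘ at Ξ Δ₁ (float Φ)
    sound (!P₂ Ξ {Δ₁} {Φ} d) = sound d ∘ at Ξ Δ₁ λ { (fm (refl , v) ∷ c) →
      let _ , p , q = split Φ c in p ⊕ fm (refl , v) ∷ q }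
    sound (!C Ξ {As} {Γ₁} {Γ₂} _ d) = sound d ∘ inside Ξ (contract As Γ₁ Γ₂)
    sound (cut Ξ {Π} {Γ₁} d e) = sound e ∘ at Ξ Γ₁ λ c →
      let _ , p , q = split Π c in fm (sound d p) ∷ q

  module StoupSoundness where
    open Stoup

    mutual
      data ⟦_⟧ᵗ : Tree → Rel P 0ℓ where
        fm  : ∀ {A s t} → ⟦ A ⟧ s t → ⟦ fm A ⟧ᵗ s t
        [_] : ∀ {Ξ s t} → ⟦ Ξ ⟧ᵐ s t → ⟦ [ Ξ ] ⟧ᵗ s t

      -- A stoup contributes no relation, only the validity of its members, as a row of formulae
      -- under `!` would.
      data ⟦_⟧ᵐ : Meta → Rel P 0ℓ where
        _⨾_ : ∀ {ζ Γ s t} → All Valid ζ → Chain ⟦_⟧ᵗ Γ s t → ⟦ ζ ⨾ Γ ⟧ᵐ s t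

    private
      C : List Tree → Rel P 0ℓ
      C = Chain ⟦_⟧ᵗ

      chain-≼ : ∀ {Γ} → C Γ ⇒ _≼_
      chain-≼ []                    = ≼-refl
      chain-≼ {fm A ∷ _} (fm a ∷ c) = ≼-trans (⟦⟧⇒≼ A a) (chain-≼ c)
      chain-≼ ([ _ ⨾ b ] ∷ c)       = ≼-trans (chain-≼ b) (chain-≼ c)

      inside : ∀ Ξ {Θ Θ′} → ⟦ Θ ⟧ᵐ ⇒ ⟦ Θ′ ⟧ᵐ → ⟦ Ξ ⟪ Θ ⟫ ⟧ᵐ ⇒ ⟦ Ξ ⟪ Θ′ ⟫ ⟧ᵐ
      inside □                 f         = f
      inside (within _ Γ₁ Ξ _) f (z ⨾ c) = z ⨾ after Γ₁ (λ { ([ b ] ∷ d) → [ inside Ξ f b ] ∷ d }) c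

      at : ∀ Ξ {ζ} Δ₁ {Δ Δ′} → C Δ ⇒ C Δ′ → ⟦ Ξ ⟪ ζ ⨾ Δ₁ ++ Δ ⟫ ⟧ᵐ ⇒ ⟦ Ξ ⟪ ζ ⨾ Δ₁ ++ Δ′ ⟫ ⟧ᵐ
      at Ξ Δ₁ f = inside Ξ λ { (z ⨾ c) → z ⨾ after Δ₁ f c }

      distinguish : ∀ Ξ Δ₁ {ζ A B Δ₂ s t} → ⟦ Ξ ⟪ ζ ⨾ Δ₁ ++ fm (A ∨ B) ∷ Δ₂ ⟫ ⟧ᵐ s t →
                    ⟦ Ξ ⟪ ζ ⨾ Δ₁ ++ fm A ∷ Δ₂ ⟫ ⟧ᵐ s t ⊎ ⟦ Ξ ⟪ ζ ⨾ Δ₁ ++ fm B ∷ Δ₂ ⟫ ⟧ᵐ s t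
      distinguish □ Δ₁ (z ⨾ c) with focus Δ₁ c
      ... | _ , _ , p , fm (inj₁ a) , q = inj₁ (z ⨾ p ⊕ fm a ∷ q)
      ... | _ , _ , p , fm (inj₂ b) , q = inj₂ (z ⨾ p ⊕ fm b ∷ q)
      distinguish (within _ Γ₁ Ξ Γ₂) Δ₁ (z ⨾ c) with focus Γ₁ c
      ... | _ , _ , p , [ b ] , q with distinguish Ξ Δ₁ b
      ... | inj₁ b₁ = inj₁ (z ⨾ p ⊕ [ b₁ ] ∷ q)
      ... | inj₂ b₂ = inj₂ (z ⨾ p ⊕ [ b₂ ] ∷ q)

      divide/ : ∀ Ξ ζ₁ Γ Δ₁ {ζ₂ A B Δ} → ⟦ ζ₁ ⨾ Γ ⟧ᵐ ⇒ ⟦ A ⟧ →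
                ⟦ Ξ ⟪ ζ₁ ++ ζ₂ ⨾ Δ₁ ++ fm (B / A) ∷ Γ ++ Δ ⟫ ⟧ᵐ ⇒ ⟦ Ξ ⟪ ζ₂ ⨾ Δ₁ ++ fm B ∷ Δ ⟫ ⟧ᵐ
      divide/ Ξ ζ₁ Γ Δ₁ a = inside Ξ λ { (z ⨾ c) → let z₁ , z₂ = ++⁻ ζ₁ z in
        z₂ ⨾ after Δ₁ (λ { (fm (_ , f) ∷ d) →
          let _ , p , q = split Γ d in fm (f _ (a (z₁ ⨾ p))) ∷ q }) c }

      divide∖ : ∀ Ξ ζ₁ Γ Δ₁ {ζ₂ A B Δ} → ⟦ ζ₁ ⨾ Γ ⟧ᵐ ⇒ ⟦ A ⟧ →
                ⟦ Ξ ⟪ ζ₁ ++ ζ₂ ⨾ Δ₁ ++ Γ ++ fm (A ∖ B) ∷ Δ ⟫ ⟧ᵐ ⇒ ⟦ Ξ ⟪ ζ₂ ⨾ Δ₁ ++ fm B ∷ Δ ⟫ ⟧ᵐ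
      divide∖ Ξ ζ₁ Γ Δ₁ {A = A} {B} {Δ} a = inside Ξ λ { (z ⨾ c) →
        let z₁ , z₂ = ++⁻ ζ₁ z in z₂ ⨾ after Δ₁ (reduce z₁) c }
        where
        reduce : All Valid ζ₁ → C (Γ ++ fm (A ∖ B) ∷ Δ) ⇒ C (fm B ∷ Δ)
        reduce z₁ c with focus Γ c
        ... | _ , _ , p , fm (_ , f) , q = fm (f _ (a (z₁ ⨾ p))) ∷ q

      enter-stoup : ∀ Γ₁ {ζ A Γ₂} → ⟦ ζ ⨾ Γ₁ ++ fm (! A) ∷ Γ₂ ⟧ᵐ ⇒ ⟦ ζ ++ A ∷ [] ⨾ Γ₁ ++ Γ₂ ⟧ᵐ
      enter-stoup Γ₁ (z ⨾ c) with focus Γ₁ c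
      ... | _ , _ , p , fm (refl , v) , q = ++⁺ z (v ∷ []) ⨾ p ⊕ q

      leave-stoup : ∀ Γ₁ {ζ A Γ₂} → ⟦ ζ ++ A ∷ [] ⨾ Γ₁ ++ Γ₂ ⟧ᵐ ⇒ ⟦ ζ ⨾ Γ₁ ++ fm A ∷ Γ₂ ⟧ᵐ
      leave-stoup Γ₁ {ζ} (z ⨾ c) with ++⁻ ζ z | split Γ₁ c
      ... | z′ , v ∷ [] | _ , p , q = z′ ⨾ p ⊕ fm (v _) ∷ q

      bracket : ∀ {ζ} → All Valid ζ → ∀ Γ₂ {Γ₃} → C (Γ₂ ++ Γ₃) ⇒ C ([ ζ ⨾ Γ₂ ] ∷ Γ₃)
      bracket z Γ₂ c = let _ , p , q = split Γ₂ c in [ z ⨾ p ] ∷ q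

    sound : ∀ {v Ξ A} → v ⊢ Ξ ⇒ A → ⟦ Ξ ⟧ᵐ ⇒ ⟦ A ⟧
    sound (perm Ξ π d) = sound d ∘ inside Ξ λ { (z ⨾ c) → All-resp-↭ (↭-sym π) z ⨾ c }
    sound ax (_ ⨾ fm a ∷ []) = a
    sound 𝟏R (_ ⨾ []) = refl
    sound (𝟏L Ξ {Δ₁ = Δ₁} d) = sound d ∘ at Ξ Δ₁ λ { (fm refl ∷ c) → c }
    sound (/L Ξ {ζ₁} {Γ = Γ} {Δ₁} d e) = sound e ∘ divide/ Ξ ζ₁ Γ Δ₁ (sound d)
    sound (/R d) (z ⨾ c) = chain-≼ c , λ _ a → sound d (z ⨾ c ⊕ fm a ∷ [])
    sound (∖L Ξ {ζ₁} {Γ = Γ} {Δ₁} d e) = sound e ∘ divide∖ Ξ ζ₁ Γ Δ₁ (sound d)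
    sound (∖R d) (z ⨾ c) = chain-≼ c , λ _ a → sound d (z ⨾ fm a ∷ c)
    sound (·L Ξ {Δ₁ = Δ₁} d) = sound d ∘ at Ξ Δ₁ λ { (fm (_ , a , b) ∷ c) → fm a ∷ fm b ∷ c }
    sound (·R {ζ₁ = ζ₁} {Δ = Δ} d e) (z ⨾ c) =
      let z₁ , z₂ = ++⁻ ζ₁ z
          _ , p , q = split Δ c
      in _ , sound d (z₁ ⨾ p) , sound e (z₂ ⨾ q)
    sound (∧L₁ Ξ {Δ₁ = Δ₁} d) = sound d ∘ at Ξ Δ₁ λ { (fm (a , _) ∷ c) → fm a ∷ c }
    sound (∧L₂ Ξ {Δ₁ = Δ₁} d) = sound d ∘ at Ξ Δ₁ λ { (fm (_ , b) ∷ c) → fm b ∷ c }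
    sound (∧R d e) m = sound d m , sound e m
    sound (∨L Ξ {Δ₁ = Δ₁} d e) m with distinguish Ξ Δ₁ m
    ... | inj₁ m₁ = sound d m₁
    ... | inj₂ m₂ = sound e m₂
    sound (∨R₁ d) = inj₁ ∘ sound d
    sound (∨R₂ d) = inj₂ ∘ sound d
    sound ([]⁻¹L Ξ {Δ₁ = Δ₁} d) = sound d ∘ at Ξ Δ₁ λ { ([ _ ⨾ fm a ∷ [] ] ∷ c) → fm a ∷ c }
    sound ([]⁻¹R d) m = sound d ([] ⨾ [ m ] ∷ [])
    sound (⟨⟩L Ξ {Δ₁ = Δ₁} d) = sound d ∘ at Ξ Δ₁ λ { (fm a ∷ c) → [ [] ⨾ fm a ∷ [] ] ∷ c }
    sound (⟨⟩R d) (_ ⨾ [ m ] ∷ []) = sound d m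
    sound (!L Ξ {Γ₁ = Γ₁} d) = sound d ∘ inside Ξ (enter-stoup Γ₁)
    sound (!P Ξ {Γ₁ = Γ₁} d) = sound d ∘ inside Ξ (leave-stoup Γ₁)
    sound (!R d) (z ⨾ []) = refl , λ _ → sound d (z ⨾ [])
    sound (!C Ξ {ζ₁} {Γ₁ = Γ₁} {Γ₂} _ d) = sound d ∘ inside Ξ λ { (z ⨾ c) →
      z ⨾ after Γ₁ (bracket (proj₂ (++⁻ ζ₁ z)) Γ₂) c }
    sound (!R′ _ d) (z ⨾ []) = refl , λ _ → sound d (z ⨾ [])
    -- The validity of `ζ₂` is used twice, outside the bracket and inside it.
    sound (!C′ Ξ {ζ₁} {ζ₂} {Γ₁ = Γ₁} {Γ₂} _ d) = sound d ∘ inside Ξ λ { (z ⨾ c) →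
      let z₁ , z₂₃ = ++⁻ ζ₁ z
          z₂ , z₃  = ++⁻ ζ₂ z₂₃
      in ++⁺ z₁ z₂ ⨾ after Γ₁ (bracket (++⁺ z₃ z₂) Γ₂) c }

-- Derivations from a fixed list of formulae under `!`, in each calculus.

module _ {ℓ : Language} where

  infixl 8 _⟋_

  -- The curried form of `A / (B₁ · … · Bₖ)`: the first divisor is outermost, so the arguments
  -- follow in list order.
  _⟋_ : Fm ℓ → List (Fm ℓ) → Fm ℓ
  A ⟋ []       = A
  A ⟋ (B ∷ Bs) = (A ⟋ Bs) / B

  -- Every formula A is accompanied by (h / h) / A, which under the succedent h
  -- consumes A and itself: this makes up for the absence of weakening.
  guarded : Fm ℓ → List (Fm ℓ) → List (Fm ℓ)
  guarded h []       = h ∷ []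
  guarded h (A ∷ As) = (h / h) / A ∷ A ∷ guarded h As

  ⊆-guarded : ∀ {h A As} → A ∈ As → A ∈ guarded h As
  ⊆-guarded (here refl) = there (here refl)
  ⊆-guarded (there i)   = there (there (⊆-guarded i))

  All-guarded : ∀ {P : Fm ℓ → Set} {h As} → P h → (∀ {A} → P A → P ((h / h) / A)) →
                All P As → All P (guarded h As)
  All-guarded p f []       = p ∷ []
  All-guarded p f (a ∷ as) = f a ∷ a ∷ All-guarded p f as

-- What the five calculi have in common: D Γ C stands for the derivability of
-- C from Γ together with the formulae of Θ under !.
record Theory {ℓ} (As : List (Fm ℓ)) (h : Fm ℓ) : Set₁ where
  field
    D    : List (Fm ℓ) → Fm ℓ → Set
    done : D [] h
    push : ∀ {Γ B C} → D (Γ ++ B ∷ []) C → D Γ (C / B)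
    use  : ∀ {Γ A B} Bs → (A / B) ⟋ Bs ∈ As → D Γ B → D (Bs ++ Γ) A

module BracketFreeTheory (v : BracketFree.Variant) (h : BracketFree.Formula) where
  open BracketFree

  private
    relocate : ∀ {Π Π′ C} → Π ≡ Π′ → v ⊢ Π ⇒ C → v ⊢ Π′ ⇒ C
    relocate {C = C} = subst (v ⊢_⇒ C)

    -- In `use`, the formulae under `!` belong to the argument of the division and so come out to
    -- the right of `Bs`; this brings them back to the front.
    gather : ∀ Δ₁ Φ Θ {Δ₂ C} → v ⊢ Δ₁ ++ Φ ++ map !_ Θ ++ Δ₂ ⇒ C → v ⊢ Δ₁ ++ map !_ Θ ++ Φ ++ Δ₂ ⇒ C
    gather Δ₁ Φ []      d = d
    gather Δ₁ Φ (A ∷ Θ) d =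
      relocate (++-assoc Δ₁ (! A ∷ []) _)
        (gather (Δ₁ ++ ! A ∷ []) Φ Θ
          (relocate (sym (++-assoc Δ₁ (! A ∷ []) _)) (!P₂ {Δ₁ = Δ₁} {Φ} d)))

    -- Dereliction turns the extra `A` into `! A`, permutation brings it next to the member of `Θ`,
    -- and contraction merges the two.
    copy : ∀ {A Θ Γ C} → A ∈ Θ → v ⊢ map !_ Θ ++ A ∷ Γ ⇒ C → v ⊢ map !_ Θ ++ Γ ⇒ C
    copy {A} {Γ = Γ} i d with Θ₁ , Θ₂ , refl ← ∈-∃++ i =
      relocate (sym (eq Γ)) (!C {Δ₁ = map !_ Θ₁} (!P₂ {Δ₁ = map !_ Θ₁} {Φ = ! A ∷ map !_ Θ₂}
        (relocate (eq (! A ∷ Γ)) (!L {Δ₁ = map !_ (Θ₁ ++ A ∷ Θ₂)} d))))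
      where
      eq : ∀ Δ → map !_ (Θ₁ ++ A ∷ Θ₂) ++ Δ ≡ map !_ Θ₁ ++ ! A ∷ map !_ Θ₂ ++ Δ
      eq Δ = trans (cong (_++ Δ) (map-++ !_ Θ₁ (A ∷ Θ₂))) (++-assoc (map !_ Θ₁) _ Δ)

    consume : ∀ {A Δ C} Bs → v ⊢ A ∷ Δ ⇒ C → v ⊢ (A ⟋ Bs) ∷ Bs ++ Δ ⇒ C
    consume []       d = d
    consume (B ∷ Bs) d = /L {Π = B ∷ []} {[]} ax (consume Bs d)

    divide : ∀ {A B Π} → v ⊢ Π ⇒ B → v ⊢ A / B ∷ Π ⇒ A
    divide {Π = Π} d = relocate (cong (_ ∷_) (++-identityʳ Π)) (/L {Δ₁ = []} d ax)

    absorb : ∀ As → v ⊢ map !_ (guarded h As) ⇒ h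
    -- The `h` that ends `guarded` is what the guards finally hand on to the succedent.
    absorb []       = !L {Δ₁ = []} ax
    absorb (A ∷ As) = !L {Δ₁ = []} (!L {Δ₁ = _ ∷ []} (/L {Π = A ∷ []} {[]} ax (divide (absorb As))))

  theory : ∀ As → Theory As h
  theory As = record
    { D    = λ Γ C → v ⊢ map !_ Θ ++ Γ ⇒ C
    ; done = relocate (sym (++-identityʳ _)) (absorb As)
    ; push = λ {Γ} d → /R (relocate (sym (++-assoc (map !_ Θ) Γ _)) d)
    ; use  = λ Bs i d → copy (⊆-guarded i) (gather [] (_ ∷ Bs) Θ (consume Bs (divide d)))
    }
    where
    Θ : List Formula
    Θ = guarded h As

module StoupFreeTheory (h : StoupFree.Formula) where
  open StoupFree

  private
    relocate : ∀ {Π Π′ C} → Π ≡ Π′ → ⊢ Π ⇒ C → ⊢ Π′ ⇒ C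
    relocate {C = C} = subst (⊢_⇒ C)

    gather : ∀ Δ₁ Φ Θ {Δ₂ C} → ⊢ Δ₁ ++ Φ ++ bangs Θ ++ Δ₂ ⇒ C → ⊢ Δ₁ ++ bangs Θ ++ Φ ++ Δ₂ ⇒ C
    gather Δ₁ Φ []      d = d
    gather Δ₁ Φ (A ∷ Θ) d =
      relocate (++-assoc Δ₁ (fm (! A) ∷ []) _)
        (gather (Δ₁ ++ fm (! A) ∷ []) Φ Θ
          (relocate (sym (++-assoc Δ₁ (fm (! A) ∷ []) _)) (!P₂ □ {Δ₁} {Φ} d)))

    -- The bracket left by contraction is removed by the modality of the copy.
    duplicate : ∀ {A Γ₁ Γ₂ C} → ⊢ fm (! []⁻¹ A) ∷ Γ₁ ++ fm A ∷ Γ₂ ⇒ C → ⊢ fm (! []⁻¹ A) ∷ Γ₁ ++ Γ₂ ⇒ C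
    duplicate {A} {Γ₁} {Γ₂} d = !C □ {As = []⁻¹ A ∷ []} {Γ₁} {[]} (λ ())
      (!L (within (fm (! []⁻¹ A) ∷ Γ₁) □ Γ₂) {[]} {[]} ([]⁻¹L □ {fm (! []⁻¹ A) ∷ Γ₁} d))

    copy : ∀ {A Θ Γ C} → []⁻¹ A ∈ Θ → ⊢ bangs Θ ++ fm A ∷ Γ ⇒ C → ⊢ bangs Θ ++ Γ ⇒ C
    copy {A} {Γ = Γ} i d with Θ₁ , Θ₂ , refl ← ∈-∃++ i =
      -- `duplicate` works at the front of the sequence: read upwards, `!P₁` brings the formula
      -- there and `!P₂` takes it back.
      relocate (sym (eq Γ)) (!P₁ □ {[]} {bangs Θ₁} (regroup⁻¹ Γ (duplicate {Γ₁ = bangs Θ₁ ++ bangs Θ₂}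
        (regroup (fm A ∷ Γ) (!P₂ □ {[]} {bangs Θ₁} (relocate (eq (fm A ∷ Γ)) d))))))
      where
      eq : ∀ Δ → bangs (Θ₁ ++ []⁻¹ A ∷ Θ₂) ++ Δ ≡ bangs Θ₁ ++ fm (! []⁻¹ A) ∷ bangs Θ₂ ++ Δ
      eq Δ = trans (cong (_++ Δ) (map-++ _ Θ₁ ([]⁻¹ A ∷ Θ₂))) (++-assoc (bangs Θ₁) _ Δ)

      regroup : ∀ Δ {T C} → ⊢ T ∷ bangs Θ₁ ++ bangs Θ₂ ++ Δ ⇒ C → ⊢ T ∷ (bangs Θ₁ ++ bangs Θ₂) ++ Δ ⇒ C
      regroup Δ = relocate (cong (_ ∷_) (sym (++-assoc (bangs Θ₁) _ Δ)))

      regroup⁻¹ : ∀ Δ {T C} → ⊢ T ∷ (bangs Θ₁ ++ bangs Θ₂) ++ Δ ⇒ C → ⊢ T ∷ bangs Θ₁ ++ bangs Θ₂ ++ Δ ⇒ C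
      regroup⁻¹ Δ = relocate (cong (_ ∷_) (++-assoc (bangs Θ₁) _ Δ))

    consume : ∀ {A Δ C} Bs → ⊢ fm A ∷ Δ ⇒ C → ⊢ fm (A ⟋ Bs) ∷ map fm Bs ++ Δ ⇒ C
    consume []       d = d
    consume (B ∷ Bs) d = /L □ {fm B ∷ []} {[]} ax (consume Bs d)

    divide : ∀ {A B Π} → ⊢ Π ⇒ B → ⊢ fm (A / B) ∷ Π ⇒ A
    divide {Π = Π} d = relocate (cong (_ ∷_) (++-identityʳ Π)) (/L □ {Δ₁ = []} {[]} d ax)

    absorb : ∀ As → ⊢ bangs (guarded h As) ⇒ h
    absorb []       = !L □ {[]} {[]} ax
    absorb (A ∷ As) = !L □ {[]} (!L □ {_ ∷ []} (/L □ {fm A ∷ []} {[]} ax (divide (absorb As))))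

  theory : ∀ As → Theory As h
  theory As = record
    { D    = λ Γ C → ⊢ bangs Θ ++ map fm Γ ⇒ C
    ; done = relocate (sym (++-identityʳ _)) (absorb (map []⁻¹_ As))
    ; push = λ {Γ} {B} d → /R (relocate (trans (cong (bangs Θ ++_) (map-++ fm Γ (B ∷ [])))
                                               (sym (++-assoc (bangs Θ) (map fm Γ) _))) d)
    ; use  = λ {Γ} Bs i d → relocate (cong (bangs Θ ++_) (sym (map-++ fm Bs Γ)))
               (copy (⊆-guarded (∈-map⁺ []⁻¹_ i)) (gather [] (_ ∷ map fm Bs) Θ (consume Bs (divide d))))
    }
    where
    Θ : List Formula
    Θ = guarded h (map []⁻¹_ As)

module StoupTheory (v : Stoup.Variant) (h : Stoup.Formula) where
  open Stoup

  private
    relocate : ∀ {ζ ζ′ Γ Γ′ C} → ζ ≡ ζ′ → Γ ≡ Γ′ → v ⊢ ζ ⨾ Γ ⇒ C → v ⊢ ζ′ ⨾ Γ′ ⇒ C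
    relocate {C = C} = subst₂ (λ ζ Γ → v ⊢ ζ ⨾ Γ ⇒ C)

    release : ∀ Γ₁ {ζ A Γ₂ C} → v ⊢ ζ ⨾ Γ₁ ++ fm A ∷ Γ₂ ⇒ C → v ⊢ A ∷ ζ ⨾ Γ₁ ++ Γ₂ ⇒ C
    release Γ₁ {ζ} {A} d = perm □ (++-comm ζ (A ∷ [])) (!P □ {Γ₁ = Γ₁} d)

    -- With `ζ′` empty, `!C′` acts as `!C`, so both calculi can copy one stoup formula into a
    -- bracket with no other content.
    contract : ∀ v {ζ A Γ C} → v ⊢ ζ ++ A ∷ [] ⨾ [ A ∷ [] ⨾ [] ] ∷ Γ ⇒ C → v ⊢ ζ ++ A ∷ [] ⨾ Γ ⇒ C
    contract plain  = !C  □ {Γ₁ = []} {[]} (λ ())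
    contract primed = !C′ □ {ζ′ = []} {[]} {[]} (λ ())

    -- Inside the bracket the copy leaves its stoup by `!P`; then `[]⁻¹L` removes both the bracket
    -- and the modality.
    copy : ∀ {A Θ Γ C} → []⁻¹ A ∈ Θ → v ⊢ Θ ⨾ fm A ∷ Γ ⇒ C → v ⊢ Θ ⨾ Γ ⇒ C
    copy {A} {Γ = Γ} i d with Θ₁ , Θ₂ , refl ← ∈-∃++ i =
      perm □ (↭-sym π) (contract v
        (!P (within ((Θ₁ ++ Θ₂) ++ []⁻¹ A ∷ []) [] □ Γ) {[]} {[]} {[]}
          ([]⁻¹L □ {Δ₁ = []} (perm □ π d))))
      where
      π : Θ₁ ++ []⁻¹ A ∷ Θ₂ ↭ (Θ₁ ++ Θ₂) ++ []⁻¹ A ∷ []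
      π = ↭-trans (shift _ Θ₁ Θ₂) (++-comm (_ ∷ []) (Θ₁ ++ Θ₂))

    consume : ∀ {A ζ Δ C} Bs → v ⊢ ζ ⨾ fm A ∷ Δ ⇒ C → v ⊢ ζ ⨾ fm (A ⟋ Bs) ∷ map fm Bs ++ Δ ⇒ C
    consume []       d = d
    consume (B ∷ Bs) d = /L □ {[]} {Γ = fm B ∷ []} {[]} ax (consume Bs d)

    divide : ∀ {A B ζ Γ} → v ⊢ ζ ⨾ Γ ⇒ B → v ⊢ ζ ⨾ fm (A / B) ∷ Γ ⇒ A
    divide d = relocate (++-identityʳ _) (cong (_ ∷_) (++-identityʳ _)) (/L □ {Δ₁ = []} {[]} d ax)

    absorb : ∀ As → v ⊢ guarded h As ⨾ [] ⇒ h
    absorb []       = release [] ax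
    absorb (A ∷ As) = release [] (release (_ ∷ []) (/L □ {[]} {Γ = fm A ∷ []} {[]} ax (divide (absorb As))))

  theory : ∀ As → Theory As h
  theory As = record
    { D    = λ Γ C → v ⊢ guarded h (map []⁻¹_ As) ⨾ map fm Γ ⇒ C
    ; done = absorb (map []⁻¹_ As)
    ; push = λ {Γ} {B} d → /R (relocate refl (map-++ fm Γ (B ∷ [])) d)
    ; use  = λ {Γ} Bs i d → relocate refl (sym (map-++ fm Bs Γ))
               (copy (⊆-guarded (∈-map⁺ []⁻¹_ i)) (consume Bs (divide d)))
    }

-- Finite types and their numberings.

record Finite (A : Set) : Set where
  field
    elements   : List A
    exhaustive : ∀ a → a ∈ elements

  number : A → ℕ
  number a = toℕ (index (exhaustive a))

  -- Looking up the position `number a` in `elements` gives `a` back, even if `elements` has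
  -- repetitions.
  number-injective : ∀ {a b} → number a ≡ number b → a ≡ b
  number-injective {a} {b} eq =
    trans (lookup-index (exhaustive a))
          (trans (cong (lookup elements) (toℕ-injective eq)) (sym (lookup-index (exhaustive b))))

open Finite

_⊎-finite_ : ∀ {A B} → Finite A → Finite B → Finite (A ⊎ B)
(F ⊎-finite G) .elements            = map inj₁ (elements F) ++ map inj₂ (elements G)
(F ⊎-finite G) .exhaustive (inj₁ a) = ∈-++⁺ˡ (∈-map⁺ inj₁ (exhaustive F a))
(F ⊎-finite G) .exhaustive (inj₂ b) = ∈-++⁺ʳ _ (∈-map⁺ inj₂ (exhaustive G b))

finite-image : ∀ {A B} → Finite A → (f : A → B) → (∀ b → ∃ λ a → f a ≡ b) → Finite B
finite-image F f onto .elements     = map f (elements F)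
finite-image F f onto .exhaustive b with a , refl ← onto b = ∈-map⁺ f (exhaustive F a)

finite-Fin : ∀ n → Finite (Fin n)
finite-Fin n = record { elements = allFin n ; exhaustive = ∈-allFin }

finite-Bool : Finite Bool
finite-Bool = record
  { elements   = true ∷ false ∷ []
  ; exhaustive = λ { true → here refl ; false → there (here refl) }
  }

_×-finite_ : ∀ {A B} → Finite A → Finite B → Finite (A × B)
(F ×-finite G) .elements           = cartesianProductWith _,_ (elements F) (elements G)
(F ×-finite G) .exhaustive (a , b) = ∈-cartesianProductWith⁺ _,_ (exhaustive F a) (exhaustive G b)

finite-Token : Finite Token
finite-Token = record
  { elements   = Token.tick ∷ Token.x ∷ Token.one ∷ Token.under ∷ Token.over ∷ Token.times ∷ Token.and ∷ Token.or
               ∷ Token.bang ∷ Token.dia ∷ Token.box ∷ open[ ∷ close] ∷ Token.semicolon ∷ Token.arrow ∷ []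
  ; exhaustive = λ where
      Token.tick      → ∈-lookup (# 0)
      Token.x         → ∈-lookup (# 1)
      Token.one       → ∈-lookup (# 2)
      Token.under     → ∈-lookup (# 3)
      Token.over      → ∈-lookup (# 4)
      Token.times     → ∈-lookup (# 5)
      Token.and       → ∈-lookup (# 6)
      Token.or        → ∈-lookup (# 7)
      Token.bang      → ∈-lookup (# 8)
      Token.dia       → ∈-lookup (# 9)
      Token.box       → ∈-lookup (# 10)
      open[           → ∈-lookup (# 11)
      close]          → ∈-lookup (# 12)
      Token.semicolon → ∈-lookup (# 13)
      Token.arrow     → ∈-lookup (# 14)
  }

-- Queue machines and the sequents that describe them.

record Alphabet : Set₁ where
  field
    State Letter : Set
    states       : Finite State
    letters      : Finite Letter

  -- A joint numbering keeps the variables for states apart from those for letters.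
  symbols : Finite (State ⊎ Letter)
  symbols = states ⊎-finite letters

  stateFm : ∀ {ℓ} → State → Fm ℓ
  stateFm q = var (number symbols (inj₁ q))

  letterFm : ∀ {ℓ} → Letter → Fm ℓ
  letterFm a = var (number symbols (inj₂ a))

  -- A variable has the same code in both languages, so fixing `bracketFree` serves all five
  -- calculi.
  letterCode : Letter → List Token
  letterCode a = codeFm {bracketFree} (letterFm a)

  succedentCode : State → List Token
  succedentCode q = Token.arrow ∷ codeFm {bracketFree} (stateFm q)

-- A machine with a queue, read at the left end and written at the right end.
data Action (S L : Set) : Set where
  halt : Action S L
  next : S → List L → Action S L
  read : (L → S × List L) → Action S L

module Queue (Α : Alphabet)
             (action : Alphabet.State Α → Action (Alphabet.State Α) (Alphabet.Letter Α)) where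
  open Alphabet Α

  Config : Set
  Config = State × List Letter

  infix 4 _⟶_ _⟶*_

  data _⟶_ : Rel Config 0ℓ where
    next : ∀ {q w r v} → action q ≡ next r v → (q , w) ⟶ (r , w ++ v)
    read : ∀ {q a w f} → action q ≡ read f → (q , a ∷ w) ⟶ (proj₁ (f a) , w ++ proj₂ (f a))

  _⟶*_ : Rel Config 0ℓ
  _⟶*_ = Star _⟶_

  -- One format for both kinds of step: `input` is removed on the left and `output` is appended on
  -- the right.
  record Rule : Set where
    constructor rule
    field
      source : State
      input  : List Letter
      target : State
      output : List Letter

  rulesFor : State → Action State Letter → List Rule
  rulesFor q halt       = []
  rulesFor q (next r v) = rule q [] r v ∷ []
  rulesFor q (read f)   = map (λ a → rule q (a ∷ []) (proj₁ (f a)) (proj₂ (f a))) (elements letters)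

  rules : List Rule
  rules = concatMap (λ q → rulesFor q (action q)) (elements states)

  -- The half of the correspondence between `rules` and steps that soundness uses; `next∈rules` and
  -- `read∈rules` serve completeness.
  rule-step : ∀ {q u r v} → rule q u r v ∈ rules → ∀ w → (q , u ++ w) ⟶ (r , w ++ v)
  rule-step i w with q , i′ ← satisfied (∈-concatMap⁻ _ {xs = elements states} i)
    with action q in eq
  ... | next r v with here refl ← i′ = next eq
  ... | read f with _ , _ , refl ← ∈-map⁻ _ i′ = read eq

  private
    rulesFor⊆rules : ∀ {q r act} → action q ≡ act → r ∈ rulesFor q act → r ∈ rules
    rulesFor⊆rules {q} refl i = ∈-concatMap⁺ _ (lose (exhaustive states q) i)

  next∈rules : ∀ {q r v} → action q ≡ next r v → rule q [] r v ∈ rules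
  next∈rules eq = rulesFor⊆rules eq (here refl)

  read∈rules : ∀ {q f} → action q ≡ read f → ∀ a → rule q (a ∷ []) (proj₁ (f a)) (proj₂ (f a)) ∈ rules
  read∈rules eq a = rulesFor⊆rules eq (∈-map⁺ _ (exhaustive letters a))

  ⟶-deterministic : ∀ {c d e} → c ⟶ d → c ⟶ e → d ≡ e
  ⟶-deterministic (next p) (next q) with refl ← trans (sym p) q = refl
  ⟶-deterministic (next p) (read q) with () ← trans (sym p) q
  ⟶-deterministic (read p) (next q) with () ← trans (sym p) q
  ⟶-deterministic (read p) (read q) with refl ← trans (sym p) q = refl

  -- Used to show that a run which halts on acceptance cannot also reach `h` with an empty queue.
  normal-form-unique : ∀ {c d e} → c ⟶* d → c ⟶* e →
                       (∀ {d′} → ¬ d ⟶ d′) → (∀ {e′} → ¬ e ⟶ e′) → d ≡ e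
  normal-form-unique ε         ε         _  _  = refl
  normal-form-unique ε         (s ◅ _)   nd _  = contradiction s nd
  normal-form-unique (s ◅ _)   ε         _  ne = contradiction s ne
  normal-form-unique (s ◅ run) (t ◅ run′) nd ne with refl ← ⟶-deterministic s t =
    normal-form-unique run run′ nd ne

  module _ {ℓ : Language} where

    ruleFm : Rule → Fm ℓ
    ruleFm (rule q u r v) = (stateFm q / (stateFm r ⟋ map letterFm v)) ⟋ map letterFm u

    ruleFms : List (Fm ℓ)
    ruleFms = map ruleFm rules

    ⟋-oneDivision : ∀ {A : Fm ℓ} w → OneDivision A → OneDivision (A ⟋ map letterFm w)
    ⟋-oneDivision []      p = p
    ⟋-oneDivision (a ∷ w) p = ⟋-oneDivision w p / var _

    ruleFms-oneDivision : All OneDivision ruleFms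
    ruleFms-oneDivision = AllP.map⁺ (All.universal (λ where
      (rule q u r v) → ⟋-oneDivision u (var _ / ⟋-oneDivision v (var _))) rules)

    guarded-oneDivision : ∀ {q As} → All OneDivision As → All OneDivision (guarded {ℓ} (stateFm q) As)
    guarded-oneDivision = All-guarded (var _) (λ p → (var _ / var _) / p)

  module Completeness {ℓ : Language} {h : State} (T : Theory {ℓ} ruleFms (stateFm h)) where
    open Theory T

    pushes : ∀ {C} w v → D (map letterFm (w ++ v)) C → D (map letterFm w) (C ⟋ map letterFm v)
    pushes     w []      d = subst (λ u → D (map letterFm u) _) (++-identityʳ w) d
    pushes {C} w (a ∷ v) d = push (subst (λ Γ → D Γ (C ⟋ map letterFm v)) (map-++ letterFm w (a ∷ []))
      (pushes (w ++ a ∷ []) v (subst (λ u → D (map letterFm u) C) (sym (++-assoc w (a ∷ []) v)) d)))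

    -- The derivation is built from the end of the run, which is `done`, backwards: each step is one
    -- `use` of its rule, preceded by a `push` for every letter it appends.
    complete : ∀ {q w} → (q , w) ⟶* (h , []) → D (map letterFm w) (stateFm q)
    complete ε = done
    complete (next {w = w} {v = v} eq ◅ run) =
      use [] (∈-map⁺ ruleFm (next∈rules eq)) (pushes w v (complete run))
    complete (read {a = a} {w} {f} eq ◅ run) =
      use (letterFm a ∷ []) (∈-map⁺ ruleFm (read∈rules eq a)) (pushes w (proj₂ (f a)) (complete run))

  -- All that the diagonal argument knows of a calculus. As `prefix` does not depend on the queue,
  -- the queue may be chosen to contain it.
  record Representation (q h : State) (P : Problem) : Set where
    open Problem P
    field
      instanceOf : List Letter → Instance
      prefix     : List Token
      code-≡     : ∀ w → code (instanceOf w) ≡ prefix ++ concatMap letterCode w ++ succedentCode q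
      sound      : ∀ w → Positive (instanceOf w) → (q , w) ⟶* (h , [])
      complete   : ∀ w → (q , w) ⟶* (h , []) → Positive (instanceOf w)

  -- By `drains`, state `h` accepts every queue; this is what makes `h` and the guards `(h / h) / A`
  -- valid.
  module Semantics (h : State) (drains : ∀ w → (h , w) ⟶* (h , [])) where

    _≼_ : Rel (List Letter) 0ℓ
    s ≼ t = ∃ λ w → s ++ w ≡ t

    ≼-refl : Reflexive _≼_
    ≼-refl = [] , ++-identityʳ _

    ≼-trans : Transitive _≼_
    ≼-trans {s} (v , refl) (w , refl) = v ++ w , sym (++-assoc s v w)

    Meaning : State ⊎ Letter → List Letter → Set
    Meaning (inj₁ q) w = (q , w) ⟶* (h , [])
    Meaning (inj₂ a) w = w ≡ a ∷ []

    -- A language model in relational form: a symbol leads from `s` to `s ++ w` for each word `w` in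
    -- its meaning. Variables that number no symbol denote the empty relation.
    V : ℕ → Rel (List Letter) 0ℓ
    V n s t = ∃₂ λ y w → number symbols y ≡ n × s ++ w ≡ t × Meaning y w

    V⇒≼ : ∀ n → V n ⇒ _≼_
    V⇒≼ _ (_ , w , _ , eq , _) = w , eq

    open Model _≼_ (λ {s} → ≼-refl {s}) ≼-trans V V⇒≼ public

    V-elim : ∀ y {s t} → V (number symbols y) s t → ∃ λ w → s ++ w ≡ t × Meaning y w
    V-elim y (_ , w , n≡ , eq , m) with refl ← number-injective symbols n≡ = w , eq , m

    letter-meaning : ∀ {ℓ} a s → ⟦ letterFm {ℓ} a ⟧ s (s ++ a ∷ [])
    letter-meaning a s = inj₂ a , a ∷ [] , refl , refl , refl

    -- Abstract in `I` and `g`, so as to serve formulae and tree terms alike.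
    queue-meaning : ∀ {T : Set} {I : T → Rel (List Letter) 0ℓ} {g : Letter → T} →
                    (∀ a s → I (g a) s (s ++ a ∷ [])) → ∀ w s → Chain I (map g w) s (s ++ w)
    queue-meaning i []      s rewrite ++-identityʳ s = []
    queue-meaning i (a ∷ w) s rewrite sym (++-assoc s (a ∷ []) w) = i a s ∷ queue-meaning i w _

    ⟋-elim : ∀ {ℓ} {A : Fm ℓ} w {s t} → ⟦ A ⟋ map letterFm w ⟧ s t → ⟦ A ⟧ s (t ++ w)
    ⟋-elim {A = A} []      {s} {t} m       = subst (⟦ A ⟧ s) (sym (++-identityʳ t)) m
    ⟋-elim {ℓ} {A} (a ∷ w) {s} {t} (_ , f) =
      subst (⟦ A ⟧ s) (++-assoc t (a ∷ []) w) (⟋-elim w (f _ (letter-meaning {ℓ} a t)))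

    ⟋-intro : ∀ {ℓ} {A : Fm ℓ} w {s t} → s ≼ t → ⟦ A ⟧ s (t ++ w) → ⟦ A ⟋ map letterFm w ⟧ s t
    ⟋-intro {A = A} []      {s} {t} s≼t m = subst (⟦ A ⟧ s) (++-identityʳ t) m
    ⟋-intro {A = A} (a ∷ w) {s} {t} s≼t m = s≼t , λ u l → extend (V-elim (inj₂ a) l)
      where
      extend : ∀ {u} → (∃ λ v → t ++ v ≡ u × v ≡ a ∷ []) → ⟦ A ⟋ map letterFm w ⟧ s u
      extend (_ , refl , refl) = ⟋-intro w (≼-trans s≼t (a ∷ [] , refl))
        (subst (⟦ A ⟧ s) (sym (++-assoc t (a ∷ []) w)) m)

    -- If `r` reaches `h` from `w ++ v`, then `q` reaches it from `u ++ w`: put the step of the rule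
    -- in front of the run. The bound `≼` provides the `w`.
    rule-valid : ∀ {ℓ r} → r ∈ rules → Valid (ruleFm {ℓ} r)
    rule-valid {ℓ} {rule q u r v} i s = ⟋-intro u ≼-refl ((u , refl) , λ t m →
      back (⟦⟧⇒≼ (stateFm r ⟋ map letterFm v) m) m)
      where
      back : ∀ {t} → (s ++ u) ≼ t → ⟦ stateFm {ℓ} r ⟋ map letterFm v ⟧ (s ++ u) t → ⟦ stateFm {ℓ} q ⟧ s t
      back (w , refl) m with w′ , eq , run ← V-elim (inj₁ r) (⟋-elim v m)
        -- Both words continue `s ++ u`, so the queue in state `r` is exactly `w ++ v`.
        with refl ← ++-cancelˡ (s ++ u) w′ (w ++ v) (trans eq (++-assoc (s ++ u) w v))
        = inj₁ q , u ++ w , refl , sym (++-assoc s u w) , rule-step i w ◅ run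

    h-meaning : ∀ {ℓ s t} → s ≼ t → ⟦ stateFm {ℓ} h ⟧ s t
    h-meaning (w , eq) = inj₁ h , w , refl , eq , drains w

    -- `h` relates any two points in the order `≼`, whatever `A` is.
    guard-valid : ∀ {ℓ} (A : Fm ℓ) → Valid ((stateFm h / stateFm h) / A)
    guard-valid {ℓ} A s = ≼-refl , λ t a → ⟦⟧⇒≼ A a , λ u m →
      h-meaning {ℓ} (≼-trans (⟦⟧⇒≼ A a) (⟦⟧⇒≼ (stateFm {ℓ} h) m))

    ruleFms-valid : ∀ {ℓ} → All Valid (ruleFms {ℓ})
    ruleFms-valid = AllP.map⁺ (All.tabulate rule-valid)

    guarded-valid : ∀ {ℓ} {As : List (Fm ℓ)} → All Valid As → All Valid (guarded (stateFm h) As)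
    guarded-valid {ℓ} = All-guarded {P = Valid} (λ _ → h-meaning {ℓ} ≼-refl) (λ {A} _ → guard-valid A)

    state-sound : ∀ {ℓ} q {w} → ⟦ stateFm {ℓ} q ⟧ [] w → (q , w) ⟶* (h , [])
    state-sound q m with _ , refl , run ← V-elim (inj₁ q) m = run

    boxed-valid : All Valid (map []⁻¹_ ruleFms)
    boxed-valid = AllP.map⁺ ruleFms-valid

    boxed-oneDivision : All OneDivision (map []⁻¹_ ruleFms)
    boxed-oneDivision = AllP.map⁺ (All.map []⁻¹_ ruleFms-oneDivision)

    module _ (v : BracketFree.Variant) (q : State) where
      open BracketFree
      open BracketFreeSoundness

      bracketFree-representation : Representation q h (restrict (derivability v) OneDivisionSequent)
      bracketFree-representation = record
        { instanceOf = λ w → (map !_ Θ ++ map letterFm w , stateFm q) ,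
                             ++⁺ Θ-oneDivision (AllP.map⁺ (All.universal (λ _ → var _) w)) , var _
        ; prefix     = codeFms (map !_ Θ)
        ; code-≡     = λ w → trans (cong (_++ succedentCode q) (code-++ w)) (++-assoc (codeFms (map !_ Θ)) _ _)
        -- The formulae under `!` stay at the empty word and the letters lead from there to `w`, so
        -- the succedent speaks of the whole queue.
        ; sound      = λ w d → state-sound {bracketFree} q (sound d
                         (valid-bangs Θ (guarded-valid ruleFms-valid)
                          ⊕ queue-meaning (letter-meaning {bracketFree}) w []))
        ; complete   = λ _ → Completeness.complete (BracketFreeTheory.theory v (stateFm h) ruleFms)
        }
        where
        Θ : List Formula
        Θ = guarded (stateFm h) ruleFms

        Θ-oneDivision : All OneDivision (map !_ Θ)
        Θ-oneDivision = AllP.map⁺ (All.map !_ (guarded-oneDivision ruleFms-oneDivision))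

        code-++ : ∀ w → codeFms (map !_ Θ ++ map letterFm w) ≡ codeFms (map !_ Θ) ++ concatMap letterCode w
        code-++ w = trans (concatMap-++ codeFm (map !_ Θ) _)
                          (cong (codeFms (map !_ Θ) ++_) (concatMap-map codeFm letterFm w))

    module _ (q : State) where
      open StoupFree
      open StoupFreeSoundness

      stoupFree-representation : Representation q h (restrict derivability OneDivisionSequent)
      stoupFree-representation = record
        { instanceOf = λ w → (bangs Θ ++ map fm (map letterFm w) , stateFm q) ,
                             ++⁺ Θ-oneDivision (AllP.map⁺ (AllP.map⁺ (All.universal (λ _ → fm (var _)) w))) , var _
        ; prefix     = codeMeta (bangs Θ)
        ; code-≡     = λ w → trans (cong (_++ succedentCode q) (code-++ (bangs Θ) w))
                             (++-assoc (codeMeta (bangs Θ)) _ _)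
        ; sound      = λ w d → state-sound {bracketed} q (sound d
                         (valid-bangs Θ (guarded-valid boxed-valid) ⊕ letters-meaning w))
        ; complete   = λ _ → Completeness.complete (StoupFreeTheory.theory (stateFm h) ruleFms)
        }
        where
        Θ : List Formula
        Θ = guarded (stateFm h) (map []⁻¹_ ruleFms)

        Θ-oneDivision : All OneDivisionTree (bangs Θ)
        Θ-oneDivision = AllP.map⁺ (All.map (λ p → fm (! p)) (guarded-oneDivision boxed-oneDivision))

        code-++ : ∀ Γ w → codeMeta (Γ ++ map fm (map letterFm w)) ≡ codeMeta Γ ++ concatMap letterCode w
        code-++ []      []      = refl
        code-++ []      (a ∷ w) = cong (letterCode a ++_) (code-++ [] w)
        code-++ (T ∷ Γ) w       = trans (cong (codeTree T ++_) (code-++ Γ w)) (sym (++-assoc (codeTree T) _ _))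

        letters-meaning : ∀ w → Chain ⟦_⟧ᵗ (map fm (map letterFm w)) [] w
        letters-meaning w = subst (λ Γ → Chain ⟦_⟧ᵗ Γ [] w) (map-∘ w)
          (queue-meaning (λ a s → fm (letter-meaning {bracketed} a s)) w [])

    module _ (v : Stoup.Variant) (q : State) where
      open Stoup
      open StoupSoundness

      stoup-representation : Representation q h (restrict (derivability v) OneDivisionSequent)
      stoup-representation = record
        { instanceOf = λ w → ((Θ ⨾ map fm (map letterFm w)) , stateFm q) ,
                             (guarded-oneDivision boxed-oneDivision
                              ⨾ AllP.map⁺ (AllP.map⁺ (All.universal (λ _ → fm (var _)) w))) , var _
        ; prefix     = codeFms Θ ++ Token.semicolon ∷ []
        ; code-≡     = λ w → trans
                         (cong (λ c → (codeFms Θ ++ Token.semicolon ∷ c) ++ succedentCode q) (code-letters w))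
                         (regroup (codeFms Θ) (Token.semicolon ∷ []) _ _)
        ; sound      = λ w d → state-sound {bracketed} q (sound d (guarded-valid boxed-valid ⨾ letters-meaning w))
        ; complete   = λ _ → Completeness.complete (StoupTheory.theory v (stateFm h) ruleFms)
        }
        where
        Θ : List Formula
        Θ = guarded (stateFm h) (map []⁻¹_ ruleFms)

        code-letters : ∀ w → codeTrees (map fm (map letterFm w)) ≡ concatMap letterCode w
        code-letters []      = refl
        code-letters (a ∷ w) = cong (letterCode a ++_) (code-letters w)

        letters-meaning : ∀ w → Chain ⟦_⟧ᵗ (map fm (map letterFm w)) [] w
        letters-meaning w = subst (λ Γ → Chain ⟦_⟧ᵗ Γ [] w) (map-∘ w)
          (queue-meaning (λ a s → fm (letter-meaning {bracketed} a s)) w [])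

        regroup : ∀ (a b c d : List Token) → (a ++ b ++ c) ++ d ≡ (a ++ b) ++ c ++ d
        regroup a b c d = solve (++-monoid Token)

-- The diagonal queue machine.

open Turing Token renaming (Config to TuringConfig; _⟶_ to TuringStep)

finite-Symbol : ∀ k → Finite (Symbol k)
-- `finite-Bool` stands in for a one-element type: both truth values go to `blank`.
finite-Symbol k = finite-image (finite-Bool ⊎-finite (finite-Token ⊎-finite finite-Fin k))
  (λ { (inj₁ _) → blank ; (inj₂ (inj₁ a)) → input a ; (inj₂ (inj₂ i)) → work i })
  (λ { blank → inj₁ true , refl ; (input a) → inj₂ (inj₁ a) , refl ; (work i) → inj₂ (inj₂ i) , refl })

finite-Move : Finite Move
finite-Move = record
  { elements   = left ∷ stay ∷ right ∷ []
  ; exhaustive = λ { left → here refl ; stay → there (here refl) ; right → there (there (here refl)) }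
  }

module Diagonal (M : Machine) where
  open Machine M

  -- The letters raw t and end form the queue of the initial sequent. The others
  -- lay out a tape cyclically, with edge between its right and its left end.
  data Letter : Set where
    raw       : Token → Letter
    end       : Letter
    cell head : Symbol #work → Letter
    edge      : Letter

  -- In state holding c s the scanned symbol s is not on the queue. A step to the
  -- left needs the last letter of the queue: carrying delays every letter by one
  -- until the head comes round, and moving c stay then rotates up to the new head.
  data State : Set where
    searching : State
    copying   : Token → State
    holding   : Control #states → Symbol #work → State
    moving    : Control #states → Move → State
    carrying  : Control #states → Letter → State
    rejected  : State

  finite-Letter : Finite Letter
  finite-Letter = finite-image
    ((finite-Bool ⊎-finite finite-Token) ⊎-finite (finite-Symbol #work ⊎-finite finite-Symbol #work))
    (λ { (inj₁ (inj₁ true)) → end ; (inj₁ (inj₁ false)) → edge ; (inj₁ (inj₂ t)) → raw t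
       ; (inj₂ (inj₁ s)) → cell s ; (inj₂ (inj₂ s)) → head s })
    (λ { (raw t) → inj₁ (inj₂ t) , refl ; end → inj₁ (inj₁ true) , refl ; edge → inj₁ (inj₁ false) , refl
       ; (cell s) → inj₂ (inj₁ s) , refl ; (head s) → inj₂ (inj₂ s) , refl })

  finite-Control : Finite (Control #states)
  finite-Control = finite-Fin #states ⊎-finite finite-Bool

  finite-State : Finite State
  finite-State = finite-image
    ((finite-Bool ⊎-finite finite-Token)
      ⊎-finite ((finite-Control ×-finite finite-Symbol #work)
      ⊎-finite ((finite-Control ×-finite finite-Move) ⊎-finite (finite-Control ×-finite finite-Letter))))
    (λ { (inj₁ (inj₁ true)) → searching ; (inj₁ (inj₁ false)) → rejected ; (inj₁ (inj₂ t)) → copying t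
       ; (inj₂ (inj₁ (c , s))) → holding c s
       ; (inj₂ (inj₂ (inj₁ (c , m)))) → moving c m
       ; (inj₂ (inj₂ (inj₂ (c , a)))) → carrying c a })
    (λ { searching → inj₁ (inj₁ true) , refl ; rejected → inj₁ (inj₁ false) , refl
       ; (copying t) → inj₁ (inj₂ t) , refl
       ; (holding c s) → inj₂ (inj₁ (c , s)) , refl
       ; (moving c m) → inj₂ (inj₂ (inj₁ (c , m))) , refl
       ; (carrying c a) → inj₂ (inj₂ (inj₂ (c , a))) , refl })

  alphabet : Alphabet
  alphabet = record { states = finite-State ; letters = finite-Letter }

  open Alphabet alphabet using (letterCode; succedentCode)

  cells : List (Symbol #work) → List Letter
  cells = map cell

  inputs : List Token → List Letter
  inputs w = cells (map input w)

  -- The machine may write the codes of its own letters and state without circularity: the numbering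
  -- depends on the alphabet alone, not on `action`.
  search : Letter → State × List Letter
  search (raw t) = copying t , cell (input t) ∷ []
  search end     = moving start right , inputs (letterCode end ++ succedentCode searching) ++ edge ∷ []
  search a       = searching , a ∷ []

  copy : Token → Letter → State × List Letter
  copy t end = searching , inputs (letterCode (raw t)) ++ end ∷ []
  copy t a   = copying t , a ∷ []

  -- A move to the right reads the next cell at once; the other moves must find the old head
  -- position again and mark it.
  leave : Move → Symbol #work → Letter
  leave right s = cell s
  leave _     s = head s

  depart : Control #states × Symbol #work × Move → State × List Letter
  depart (c , s , m) = moving c m , leave m s ∷ []

  travel : Control #states → Move → Letter → State × List Letter
  travel c right (cell s) = holding c s , []
  travel c right _        = moving c stay , head blank ∷ edge ∷ []
  travel c left  a        = carrying c a , []
  travel c stay  (head s) = holding c s , []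
  travel c stay  a        = moving c stay , a ∷ []

  -- An `edge` just before the head means that the tape has no cell to the left; a blank one is
  -- created after the edge, at the left end.
  enterHead : Letter → List Letter
  enterHead (cell s) = head s ∷ []
  enterHead a        = a ∷ head blank ∷ []

  carry : Control #states → Letter → Letter → State × List Letter
  carry c a (head s) = moving c stay , enterHead a ++ cell s ∷ []
  carry c a b        = carrying c b , a ∷ []

  action : State → Action State Letter
  action searching                = read search
  action (copying t)              = read (copy t)
  action (holding (inj₁ q) s)     = next (proj₁ (depart (δ q s))) (proj₂ (depart (δ q s)))
  -- The verdict of `M` is turned against it: acceptance blocks the run, while rejection leads to
  -- `rejected`, which plays the part of `h`.
  action (holding (inj₂ true) s)  = halt
  action (holding (inj₂ false) s) = next rejected []
  action (moving c m)             = read (travel c m)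
  action (carrying c a)           = read (carry c a)
  action rejected                 = read (λ _ → rejected , [])

  open Queue alphabet action public

  drains : ∀ w → (rejected , w) ⟶* (rejected , [])
  drains []      = ε
  drains (a ∷ w) = read refl ◅ subst (λ v → (rejected , v) ⟶* (rejected , [])) (sym (++-identityʳ w)) (drains w)

  requeue : ∀ {c q v w} → v ≡ w → c ⟶* (q , v) → c ⟶* (q , w)
  requeue {c} {q} = subst (λ v → c ⟶* (q , v))

  rotate : ∀ {q f} → action q ≡ read f → ∀ {v} w → All (λ a → f a ≡ (q , a ∷ [])) v → (q , v ++ w) ⟶* (q , w ++ v)
  rotate eq w []                        = requeue (sym (++-identityʳ w)) ε
  rotate {q} {f} eq {a ∷ v} w (p ∷ ps) =
    subst (λ d → (q , a ∷ v ++ w) ⟶ (proj₁ d , (v ++ w) ++ proj₂ d)) p (read eq) ◅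
    subst₂ (λ u u′ → (q , u) ⟶* (q , u′)) (sym (++-assoc v w (a ∷ []))) (++-assoc w (a ∷ []) v)
      (rotate eq (w ++ a ∷ []) ps)

  data Passive : Letter → Set where
    cell : ∀ s → Passive (cell s)
    edge : Passive edge

  passive-cells : ∀ ss → All Passive (cells ss)
  passive-cells ss = AllP.map⁺ (All.universal cell ss)

  -- The queue starts just right of the head and runs around to its left neighbour, whereas a tape
  -- lists the left cells nearest first.
  belt : List (Symbol #work) → List (Symbol #work) → List Letter
  belt ls rs = cells rs ++ edge ∷ cells (reverse ls)

  passive-belt : ∀ ls rs → All Passive (belt ls rs)
  passive-belt ls rs = ++⁺ (passive-cells rs) (edge ∷ passive-cells (reverse ls))

  belt-∷ : ∀ l ls rs → belt ls rs ++ cell l ∷ [] ≡ belt (l ∷ ls) rs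
  belt-∷ l ls rs = begin
    belt ls rs ++ cell l ∷ []
      ≡⟨ ++-assoc (cells rs) _ _ ⟩
    cells rs ++ edge ∷ cells (reverse ls) ++ cell l ∷ []
      ≡⟨ cong (λ v → cells rs ++ edge ∷ v) (map-++ cell (reverse ls) _) ⟨
    cells rs ++ edge ∷ cells (reverse ls ++ l ∷ [])
      ≡⟨ cong (λ v → cells rs ++ edge ∷ cells v) (unfold-reverse l ls) ⟨
    belt (l ∷ ls) rs ∎
    where open ≡-Reasoning

  embed : TuringConfig M → Config
  embed (c , tape ls s rs) = holding c s , belt ls rs

  seek : ∀ c s {v} w → All Passive v → (moving c stay , v ++ head s ∷ w) ⟶* (holding c s , w ++ v)
  seek c s {v} w ps =
    rotate refl (head s ∷ w) (All.map (λ { (cell _) → refl ; edge → refl }) ps) ◅◅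
    read refl ◅ requeue (++-identityʳ (w ++ v)) ε

  -- When `head s` comes up, all earlier letters have been released and the one still carried is
  -- `b`, the left neighbour. The induction lets `w` grow by the released letters.
  carry-last : ∀ c s a b {v} w → All Passive v → Passive b →
               (carrying c a , (v ++ b ∷ []) ++ head s ∷ w) ⟶*
               (moving c stay , w ++ a ∷ v ++ enterHead b ++ cell s ∷ [])
  carry-last c s a b {[]}    w []       p  = pass p ◅ read refl ◅ requeue (++-assoc w (a ∷ []) _) ε
    where
    pass : ∀ {b} → Passive b → (carrying c a , b ∷ head s ∷ w) ⟶ (carrying c b , (head s ∷ w) ++ a ∷ [])
    pass (cell _) = read refl
    pass edge     = read refl
  carry-last c s a b {d ∷ v} w (p ∷ ps) p′ =
    pass p ◅ subst₂ (λ u u′ → (carrying c d , u) ⟶* (moving c stay , u′))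
      (sym (++-assoc (v ++ b ∷ []) (head s ∷ w) (a ∷ []))) (++-assoc w (a ∷ []) _)
      (carry-last c s d b (w ++ a ∷ []) ps p′)
    where
    pass : ∀ {d u} → Passive d → (carrying c a , d ∷ u) ⟶ (carrying c d , u ++ a ∷ [])
    pass (cell _) = read refl
    pass edge     = read refl

  retreat : ∀ c s b {v} → All Passive v → Passive b →
            (moving c left , (v ++ b ∷ []) ++ head s ∷ []) ⟶* (moving c stay , v ++ enterHead b ++ cell s ∷ [])
  retreat c s b []               p = read refl ◅ read refl ◅ ε
  retreat c s b {a ∷ v} (_ ∷ ps) p =
    read refl ◅ subst (λ u → (carrying c a , u) ⟶* (moving c stay , a ∷ v ++ enterHead b ++ cell s ∷ []))
                      (sym (++-identityʳ _)) (carry-last c s a b [] ps p)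

  travels : ∀ c m ls s rs → (moving c m , belt ls rs ++ leave m s ∷ []) ⟶* embed (c , move m (tape ls s rs))
  travels c stay  ls s rs = seek c s [] (passive-belt ls rs)
  travels c right ls s [] =
    read refl ◅ requeue (belt-∷ s ls []) (seek c blank (edge ∷ []) (++⁺ (passive-cells (reverse ls)) (cell s ∷ [])))
  travels c right ls s (r ∷ rs) = read refl ◅ requeue (trans (++-identityʳ _) (belt-∷ s ls rs)) ε
  travels c left [] s rs =
    -- With no cells on the left, the letter before the head mark is `edge`.
    retreat c s edge (passive-cells rs) edge ◅◅
    subst (λ v → (moving c stay , v) ⟶* embed (c , tape [] blank (s ∷ rs))) (++-assoc (cells rs) (edge ∷ []) _)
      (seek c blank (cell s ∷ []) (passive-belt [] rs))
  travels c left (l ∷ ls) s rs =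
    subst (λ v → (moving c left , v ++ head s ∷ []) ⟶* (moving c stay , belt ls rs ++ head l ∷ cell s ∷ []))
      (belt-∷ l ls rs) (retreat c s (cell l) (passive-belt ls rs) (cell l)) ◅◅
    seek c l (cell s ∷ []) (passive-belt ls rs)

  simulate : ∀ {C D} → Star (TuringStep M) C D → embed C ⟶* embed D
  simulate ε                              = ε
  simulate (step {q} {ls} {s} {rs} ◅ run) =
    let c , s′ , m = δ q s in next refl ◅ travels c m ls s′ rs ◅◅ simulate run

  -- A move to the right from before the first cell scans the first token or, on an empty word, a
  -- new blank, in agreement with `initial`.
  begin-tape : ∀ w → (moving start right , inputs w ++ edge ∷ []) ⟶* embed (start , initial w)
  begin-tape []      = read refl ◅ read refl ◅ ε
  begin-tape (a ∷ w) = read refl ◅ requeue (++-identityʳ _) ε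

  query : List Token → List Letter
  query w = map raw w ++ end ∷ []

  inputs-++ : ∀ v w → inputs (v ++ w) ≡ inputs v ++ inputs w
  inputs-++ v w = trans (cong cells (map-++ input v w)) (map-++ cell (map input v) (map input w))

  inputs-searched : ∀ w → All (λ a → search a ≡ (searching , a ∷ [])) (inputs w)
  inputs-searched w = AllP.map⁺ (AllP.map⁺ (All.universal (λ _ → refl) w))

  inputs-copied : ∀ t w → All (λ a → copy t a ≡ (copying t , a ∷ [])) (inputs w)
  inputs-copied t w = AllP.map⁺ (AllP.map⁺ (All.universal (λ _ → refl) w))

  raws-copied : ∀ t w → All (λ a → copy t a ≡ (copying t , a ∷ [])) (map raw w)
  raws-copied t w = AllP.map⁺ (All.universal (λ _ → refl) w)

  private
    regroup₁ : ∀ (a b c d e : List Letter) → ((a ++ b ++ c) ++ d) ++ e ≡ (a ++ b) ++ c ++ d ++ e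
    regroup₁ a b c d e = solve (++-monoid Letter)

    regroup₂ : ∀ (a b c d e : List Letter) → (a ++ b ++ c) ++ d ++ e ≡ a ++ b ++ (c ++ d) ++ e
    regroup₂ a b c d e = solve (++-monoid Letter)

  -- Each round trip of the queue replaces one raw token by its tape symbol and
  -- appends the code of its letter to the tape.
  expand : ∀ u v w → (searching , inputs u ++ map raw w ++ inputs v ++ end ∷ []) ⟶*
                     (searching , inputs (u ++ w) ++ inputs (v ++ concatMap letterCode (map raw w)) ++ end ∷ [])
  expand u v []      =
    requeue (cong₂ (λ u v → inputs u ++ inputs v ++ end ∷ []) (sym (++-identityʳ u)) (sym (++-identityʳ v))) ε
  expand u v (t ∷ w) =
    rotate refl (map raw (t ∷ w) ++ inputs v ++ end ∷ []) (inputs-searched u) ◅◅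
    read refl ◅
    requeue eq₁ ε ◅◅
    rotate refl (end ∷ inputs u ++ cell (input t) ∷ []) (++⁺ (raws-copied t w) (inputs-copied t v)) ◅◅
    read refl ◅
    requeue eq₂ ε ◅◅
    requeue eq₃ (expand (u ++ t ∷ []) (v ++ letterCode (raw t)) w)
    where
    eq₁ : ((map raw w ++ inputs v ++ end ∷ []) ++ inputs u) ++ cell (input t) ∷ []
          ≡ (map raw w ++ inputs v) ++ end ∷ inputs u ++ cell (input t) ∷ []
    eq₁ = regroup₁ (map raw w) (inputs v) (end ∷ []) (inputs u) (cell (input t) ∷ [])

    eq₂ : ((inputs u ++ cell (input t) ∷ []) ++ map raw w ++ inputs v) ++ inputs (letterCode (raw t)) ++ end ∷ []
          ≡ inputs (u ++ t ∷ []) ++ map raw w ++ inputs (v ++ letterCode (raw t)) ++ end ∷ []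
    eq₂ rewrite inputs-++ u (t ∷ []) | inputs-++ v (letterCode (raw t)) =
      regroup₂ (inputs u ++ cell (input t) ∷ []) (map raw w) (inputs v) (inputs (letterCode (raw t))) (end ∷ [])

    eq₃ : inputs ((u ++ t ∷ []) ++ w) ++ inputs ((v ++ letterCode (raw t)) ++ concatMap letterCode (map raw w)) ++ end ∷ []
          ≡ inputs (u ++ t ∷ w) ++ inputs (v ++ letterCode (raw t) ++ concatMap letterCode (map raw w)) ++ end ∷ []
    eq₃ = cong₂ (λ u v → inputs u ++ inputs v ++ end ∷ []) (++-assoc u _ w) (++-assoc v _ _)

  -- The queue spells out only `w`, but the tape also receives the code of that queue and of the
  -- succedent. For `w` the prefix of a representation, this is the code of the very sequent with
  -- queue `query w`.
  quine : ∀ w → (searching , query w) ⟶*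
                embed (start , initial (w ++ concatMap letterCode (query w) ++ succedentCode searching))
  quine w =
    expand [] [] w ◅◅
    requeue (sym (++-assoc (inputs w) _ _)) ε ◅◅
    -- No raw letter is left, so the search passes all cells and meets `end`, which adds its own
    -- code and that of the succedent.
    rotate refl (end ∷ []) (++⁺ (inputs-searched w) (inputs-searched codes)) ◅◅
    read refl ◅
    requeue eq ε ◅◅
    begin-tape _
    where
    codes : List Token
    codes = concatMap letterCode (map raw w)

    eq : (inputs w ++ inputs codes) ++ inputs (letterCode end ++ succedentCode searching) ++ edge ∷ []
         ≡ inputs (w ++ concatMap letterCode (query w) ++ succedentCode searching) ++ edge ∷ []
    eq = begin
      (inputs w ++ inputs codes) ++ inputs (letterCode end ++ succedentCode searching) ++ edge ∷ []
        ≡⟨ cong (λ v → v ++ inputs (letterCode end ++ succedentCode searching) ++ edge ∷ []) (inputs-++ w codes) ⟨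
      inputs (w ++ codes) ++ inputs (letterCode end ++ succedentCode searching) ++ edge ∷ []
        ≡⟨ ++-assoc (inputs (w ++ codes)) _ _ ⟨
      (inputs (w ++ codes) ++ inputs (letterCode end ++ succedentCode searching)) ++ edge ∷ []
        ≡⟨ cong (_++ edge ∷ []) (inputs-++ (w ++ codes) _) ⟨
      inputs ((w ++ codes) ++ letterCode end ++ succedentCode searching) ++ edge ∷ []
        ≡⟨ cong (λ v → inputs v ++ edge ∷ []) (regroup w codes (letterCode end) (succedentCode searching)) ⟩
      inputs (w ++ (codes ++ letterCode end ++ []) ++ succedentCode searching) ++ edge ∷ []
        ≡⟨ cong (λ v → inputs (w ++ v ++ succedentCode searching) ++ edge ∷ []) (concatMap-++ letterCode (map raw w) _) ⟨
      inputs (w ++ concatMap letterCode (query w) ++ succedentCode searching) ++ edge ∷ [] ∎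
      where
      open ≡-Reasoning
      regroup : ∀ (a b c d : List Token) → (a ++ b) ++ c ++ d ≡ a ++ (b ++ c ++ []) ++ d
      regroup a b c d = solve (++-monoid Token)

  -- No case distinction on derivability is made: `negative` refutes it, since acceptance would
  -- block the run that soundness sends to `rejected`; then `M` must reject, and that run yields a
  -- derivation after all.
  ¬decides : ∀ {P} → Representation searching rejected P → ¬ Decides P M
  ¬decides {P} rep decides = negative positive
    where
    open Problem P
    open Representation rep

    w : List Letter
    w = query prefix

    follow : ∀ {b} → HaltsWith M b (code (instanceOf w)) →
             ∃₂ λ s v → (searching , w) ⟶* (holding (inj₂ b) s , v)
    follow (tape ls s rs , run) = s , belt ls rs ,
      quine prefix ◅◅ simulate (subst (λ v → Star (TuringStep M) (start , initial v) _) (code-≡ w) run)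

    negative : ¬ Positive (instanceOf w)
    negative p with _ , _ , run ← follow (proj₁ (decides (instanceOf w)) p)
      with () ← normal-form-unique (sound w p) run (λ { (next ()) }) (λ { (next ()) ; (read ()) })

    positive : Positive (instanceOf w)
    positive with _ , _ , run ← follow (proj₂ (decides (instanceOf w)) negative) =
      complete w (run ◅◅ next refl ◅ drains _)

  open Semantics rejected drains public
    using (bracketFree-representation; stoupFree-representation; stoup-representation)

-- Undecidability of the five fragments.

undecidable : ∀ {P} → (∀ M → let open Diagonal M in Representation searching rejected P) → Undecidable P
undecidable rep (M , d) = Diagonal.¬decides M (rep M) d

theorem13 : Undecidable 𝓔-OneDivision
    × Undecidable 𝓔ʳ-OneDivision
    × Undecidable 𝓕₂₀₁₅-OneDivision
    × Undecidable 𝓜′₂₀₁₅-OneDivision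
    × Undecidable 𝓜₂₀₁₅-OneDivision
theorem13 =
    undecidable (λ M → let open Diagonal M in bracketFree-representation BracketFree.full searching)
  , undecidable (λ M → let open Diagonal M in bracketFree-representation BracketFree.relevant searching)
  , undecidable (λ M → let open Diagonal M in stoupFree-representation searching)
  , undecidable (λ M → let open Diagonal M in stoup-representation Stoup.primed searching)
  , undecidable (λ M → let open Diagonal M in stoup-representation Stoup.plain searching)
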